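{- (i) For $k\ge 2$ and $n\ge \max\{3k,4k-3\}$, $\mathrm{sat}(n,k\mathcal{C}_{\ge3})\le n+6k-7$. (ii) For $k\ge 2$ and $n\ge 4k-1$, $[n+6k-7,2n+2k-6]\subset \mathrm{ES}(n,k\mathcal{C}_{\ge3})$. (iii) For $k\ge 3$ and $n\ge 5k-1$, $[n+6k-7,3n-3k-3]\subset \mathrm{ES}(n,k\mathcal{C}_{\ge3})$. (iv) For $k\ge 5$ and $n\ge 5k-4$, $[2n+4k^2-24k+34,(2k-5)n-6k^2+21k-3]\subset \mathrm{ES}(n,k\mathcal{C}_{\ge3})$. (v) For $k\ge 2$ and $n\ge 3k$, $\{n-2k^2+k+(2k-2)t: t\in[3k,n]\}\subset \mathrm{ES}(n,k\mathcal{C}_{\ge3})$.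
   Context: All graphs are finite and simple. For integers $a\le b$, $[a,b]=\{a,\dots,b\}$. A graph $G$ is $k\mathcal{C}_{\ge3}$-saturated if it does not contain $k$ pairwise vertex-disjoint cycles, but for every pair of non-adjacent vertices $u,v$, $G+uv$ contains $k$ pairwise vertex-disjoint cycles. $\mathrm{sat}(n,k\mathcal{C}_{\ge3})$ is the minimum number of edges of an $n$-vertex $k\mathcal{C}_{\ge3}$-saturated graph, and $\mathrm{ES}(n,k\mathcal{C}_{\ge3})$ is the set of numbers of edges of all $n$-vertex $k\mathcal{C}_{\ge3}$-saturated graphs. -}

module Defs where

open import Data.Nat using (ℕ; zero; suc; _+_; _<ᵇ_; _≤_)
open import Data.Fin using (Fin; toℕ; _≟_)
open import Data.Bool using (Bool; true; false; _∧_; _∨_; if_then_else_)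
open import Data.List using (List; []; _∷_; _++_; [_]; length; map; allFin; concat)
open import Data.Nat.ListAction using (sum)
open import Data.List.Relation.Unary.All using (All)
open import Data.List.Relation.Unary.Unique.Propositional using (Unique)
open import Data.Vec using (Vec; toList)
open import Data.Product using (Σ; _×_; ∃)
open import Data.Unit using (⊤)
open import Data.Empty using (⊥)
open import Relation.Nullary using (¬_; ⌊_⌋)
open import Relation.Binary.PropositionalEquality using (_≡_; _≢_)

record Graph (n : ℕ) : Set where
  field
    adj    : Fin n → Fin n → Bool
    sym    : ∀ i j → adj i j ≡ adj j i
    irrefl : ∀ i → adj i i ≡ false
open Graph public

Adj : ℕ → Set
Adj n = Fin n → Fin n → Bool

edgeCount : ∀ {n} → Graph n → ℕ
edgeCount {n} G =
  sum (map (λ i → sum (map (λ j → if (toℕ i <ᵇ toℕ j) ∧ adj G i j then 1 else 0)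
                           (allFin n)))
           (allFin n))

addEdge : ∀ {n} → Adj n → Fin n → Fin n → Adj n
addEdge A u v i j =
  A i j ∨ ((⌊ i ≟ u ⌋ ∧ ⌊ j ≟ v ⌋) ∨ (⌊ i ≟ v ⌋ ∧ ⌊ j ≟ u ⌋))

Walk : ∀ {n} → Adj n → List (Fin n) → Set
Walk A []           = ⊤
Walk A (x ∷ [])     = ⊤
Walk A (x ∷ y ∷ ys) = A x y ≡ true × Walk A (y ∷ ys)

-- xs = x₀ … x_{l-1} (l ≥ 3) traces a closed walk x₀ … x_{l-1} x₀;
-- distinctness of the vertices is imposed by Unique below.
IsCycle : ∀ {n} → Adj n → List (Fin n) → Set
IsCycle A xs = 3 ≤ length xs ×
  Σ _ λ x → Σ (List _) λ ys → xs ≡ x ∷ ys × Walk A (x ∷ ys ++ [ x ])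

-- A contains k pairwise vertex-disjoint cycles (each cycle has
-- distinct vertices, and different cycles share no vertex)
HasKDisjointCycles : ∀ {n} → Adj n → ℕ → Set
HasKDisjointCycles {n} A k =
  Σ (Vec (List (Fin n)) k) λ cs →
    All (IsCycle A) (toList cs) × Unique (concat (toList cs))

Saturated : ∀ {n} → ℕ → Graph n → Set
Saturated k G =
  ¬ HasKDisjointCycles (adj G) k ×
  (∀ u v → u ≢ v → adj G u v ≡ false → HasKDisjointCycles (addEdge (adj G) u v) k)

InES : ℕ → ℕ → ℕ → Set
InES n k m = Σ (Graph n) λ G → Saturated k G × edgeCount G ≡ m

-- sat(n, k C_{≥3}) ≤ m  (the minimum of ES is at most m)
SatLe : ℕ → ℕ → ℕ → Set
SatLe n k m = Σ ℕ λ m' → m' ≤ m × InES n k m'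

module Submission where

-- All graphs are one-point unions, at a common root, of blocks: K₂ (a pendant edge), K₅, the join of K_{2c+1}
-- with independent vertices, and a 7-vertex graph whose root may be duplicated. A cycle of a one-point union
-- lies in one block, so maximal numbers of disjoint cycles add up. If, moreover, every vertex of a block is
-- joined to the root by a path that some maximum family of disjoint cycles avoids, then an edge between two
-- blocks closes the two paths into one more cycle, so the union is again saturated. The number of edges minus
-- the number of non-root vertices is 0 for K₂, 6 for K₅, 6 + q for the 7-vertex graph with q duplicates, and
-- grows in steps of 2c for the joins; combining blocks fills the intervals.

open import Defs
open import Data.Bool using (Bool; true; false; _∧_; _∨_; not; if_then_else_)
open import Data.Bool.Properties using (∨-zeroʳ) renaming (_≟_ to _≟ᵇ_)
open import Data.Fin using (Fin; zero; suc; _≟_; _↑ˡ_; _↑ʳ_; splitAt; toℕ)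
open import Data.Fin.Patterns
open import Data.Fin.Properties
  using (suc-injective; ↑ˡ-injective; ↑ʳ-injective; splitAt-↑ˡ; splitAt-↑ʳ; join-splitAt; all?)
open import Data.List using (List; []; _∷_; _++_; [_]; length; map; concat; reverse; allFin; tabulate; filter)
open import Data.List.Membership.Propositional using (_∈_; find)
open import Data.List.Membership.Propositional.Properties
  using (∈-++⁺ˡ; ∈-++⁺ʳ; ∈-++⁻; ∈-map⁺; ∈-map⁻; ∈-∃++; ∈-allFin; ∈-filter⁻)
open import Data.List.Properties
  using (unfold-reverse; map-++; concat-map; length-map; length-++; concat-++; ++-assoc; ++-identityʳ;
    map-tabulate; map-cong; filter-all; length-tabulate)
open import Data.List.Relation.Binary.Disjoint.Propositional using (Disjoint)
open import Data.List.Relation.Binary.Permutation.Propositional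
  using (_↭_; ↭-refl; ↭-sym; ↭-trans; prep; swap; ↭⇒↭ₛ; module PermutationReasoning)
open import Data.List.Relation.Binary.Permutation.Propositional.Properties
  using (++-comm; shifts; shift; ∈-resp-↭; All-resp-↭; ↭-length; ↭-reverse)
  renaming (++⁺ˡ to ↭-++⁺ˡ; ++⁺ʳ to ↭-++⁺ʳ; map⁺ to ↭-map⁺)
import Data.List.Relation.Binary.Permutation.Setoid.Properties as ↭ₛ
open import Data.List.Relation.Unary.All as All using (All; []; _∷_)
import Data.List.Relation.Unary.All.Properties as Allₚ
open import Data.List.Relation.Unary.AllPairs using ([]; _∷_)
open import Data.List.Relation.Unary.Any as Any using (here; there)
import Data.List.Relation.Unary.Unique.DecPropositional as Unique?
open import Data.List.Relation.Unary.Unique.Propositional using (Unique)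
import Data.List.Relation.Unary.Unique.Propositional.Properties as Uniqueₚ
open import Data.Nat using (ℕ; zero; suc; _+_; _*_; _≤_; _<_; _<ᵇ_; _⊔_; z≤n; s≤s; s≤s⁻¹)
import Data.Nat as N
open import Data.Nat.DivMod using (_/_; _%_; m≡m%n+[m/n]*n; m%n<n)
import Data.Nat.ListAction as List
open import Data.Nat.ListAction.Properties using (sum-++; sum-↭)
open import Data.Nat.Properties
  using (≤-trans; ≤-refl; ≤-reflexive; ≤-<-trans; <⇒≱; +-mono-≤; +-monoʳ-≤; m≤m+n; m≤n+m; +-assoc;
    +-comm; +-suc; +-identityʳ; *-identityʳ; *-zeroʳ; *-comm; *-suc; *-distribʳ-+; +-cancelˡ-≤;
    *-cancelˡ-≤; *-cancelˡ-<; n≢0⇒n>0; m≤n⇒∃[o]m+o≡n; m≤n+m∸n; m⊔n≤o⇒n≤o; m+n∸n≡m; +-0-commutativeMonoid;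
    module ≤-Reasoning)
open import Data.Nat.Tactic.RingSolver using (solve-∀)
open import Data.Product using (Σ; ∃; ∃₂; _×_; _,_; proj₁; proj₂; map₂)
open import Data.Sum as Sum using (_⊎_; inj₁; inj₂; [_,_]′)
open import Data.Unit using (tt)
open import Data.Vec using (fromList; toList)
open import Data.Vec.Properties using (toList∘fromList; length-toList)
open import Function using (_∘_; id)
open import Relation.Binary.PropositionalEquality
  using (_≡_; _≢_; refl; trans; cong; cong₂; subst; setoid)
  renaming (sym to ≡-sym)
open import Relation.Nullary using (¬_; Dec; yes; no; contradiction)
open import Relation.Nullary.Decidable using (map′; _×-dec_; _→-dec_; ¬?; ⌊_⌋; from-yes)
open import Algebra.Properties.CommutativeMonoid.Sum +-0-commutativeMonoid
  using (sum-cong-≗; sum-replicate-zero)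
  renaming (sum to ∑)

-- A union of blocks on n vertices has n - 1 edges plus the sum of the block differences, because
-- the n - 1 non-root vertices are shared out among the blocks. Pendant edges thus only fill up the
-- vertex number, and k - 1 copies of K₅ give n + 6k - 7. Going up means trading pendant edges for
-- duplicated roots or further independent vertices, so the upper end of an interval reflects how
-- many vertices are available. The 7-vertex graph is chosen because it starts at the same 6 as K₅
-- and, with two edges per duplicate, moves in steps of 1; the remainders modulo 2c that a large
-- join leaves are made up by this graph and a join with K₃.
--
-- The bound on disjoint cycles in a block has to cover infinite families, so it comes from vertex
-- weights: a core carries positive weight, all other vertices weigh 0, and any two neighbours of a
-- vertex of weight 0 already weigh as much as a cycle has to. Duplicates and further independent
-- vertices weigh 0 and leave this bound unchanged.

private variable
  V W : Set
  k m n : ℕ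

-- Lists without repetition

Unique-resp-↭ : {xs ys : List V} → xs ↭ ys → Unique xs → Unique ys
Unique-resp-↭ {V = V} p = ↭ₛ.Unique-resp-↭ (setoid V) (↭⇒↭ₛ p)

++-unique⁻ˡ : (xs {ys} : List V) → Unique (xs ++ ys) → Unique xs
++-unique⁻ˡ []       _        = []
++-unique⁻ˡ (x ∷ xs) (p ∷ u) = Allₚ.++⁻ˡ xs p ∷ ++-unique⁻ˡ xs u

++-unique⁻ʳ : (xs {ys} : List V) → Unique (xs ++ ys) → Unique ys
++-unique⁻ʳ []       u       = u
++-unique⁻ʳ (x ∷ xs) (_ ∷ u) = ++-unique⁻ʳ xs u

++-disjoint : (xs {ys} : List V) → Unique (xs ++ ys) → Disjoint xs ys
++-disjoint (x ∷ xs) (p ∷ _) (here refl , v∈ys) = All.lookup (Allₚ.++⁻ʳ xs p) v∈ys refl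
++-disjoint (x ∷ xs) (_ ∷ u) (there v∈xs , v∈ys) = ++-disjoint xs u (v∈xs , v∈ys)

-- Paths and cycles

data Path {V : Set} (A : V → V → Bool) : V → V → List V → Set where
  stop : ∀ {x} → Path A x x [ x ]
  _◅_  : ∀ {x y z l} → A x y ≡ true → Path A y z l → Path A x z (x ∷ l)

infixr 5 _◅_

module _ {A : V → V → Bool} where

  path-++ : ∀ {x y y′ z l l′} → Path A x y l → A y y′ ≡ true → Path A y′ z l′ → Path A x z (l ++ l′)
  path-++ stop    e q = e ◅ q
  path-++ (d ◅ p) e q = d ◅ path-++ p e q

  path-reverse : (∀ i j → A i j ≡ A j i) → ∀ {x y l} → Path A x y l → Path A y x (reverse l)
  path-reverse A-sym stop = stop
  path-reverse A-sym (_◅_ {x} {y} {l = l} d p) rewrite unfold-reverse x l =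
    path-++ (path-reverse A-sym p) (trans (A-sym y x) d) stop

  target∈ : ∀ {x y l} → Path A x y l → y ∈ l
  target∈ stop    = here refl
  target∈ (_ ◅ p) = there (target∈ p)

path-map : {A : V → V → Bool} {B : W → W → Bool} (f : V → W) →
           (∀ i j → A i j ≡ true → B (f i) (f j) ≡ true) →
           ∀ {x y l} → Path A x y l → Path B (f x) (f y) (map f l)
path-map f hom stop    = stop
path-map f hom (d ◅ p) = hom _ _ d ◅ path-map f hom p

path-⊆ : {A B : V → V → Bool} → (∀ i j → A i j ≡ true → B i j ≡ true) → ∀ {x y l} → Path A x y l → Path B x y l
path-⊆ A⊆B stop    = stop
path-⊆ A⊆B (d ◅ p) = A⊆B _ _ d ◅ path-⊆ A⊆B p

-- In contrast to `IsCycle`, the closing edge is kept apart from the path, so that mapping and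
-- rotating a cycle reduce to operations on paths.
record Cycle {V : Set} (A : V → V → Bool) (l : List V) : Set where
  constructor cycle
  field
    {source target} : V
    path            : Path A source target l
    close           : A target source ≡ true
    long            : 3 ≤ length l

cycle-map : {A : V → V → Bool} {B : W → W → Bool} (f : V → W) →
            (∀ i j → A i j ≡ true → B (f i) (f j) ≡ true) →
            ∀ {l} → Cycle A l → Cycle B (map f l)
cycle-map f hom {l} (cycle p e 3≤) =
  cycle (path-map f hom p) (hom _ _ e) (subst (3 ≤_) (≡-sym (length-map f l)) 3≤)

walk⇒path : {A : Adj n} (x : Fin n) (ys : List (Fin n)) {z : Fin n} → Walk A (x ∷ ys ++ [ z ]) →
            ∃ λ y → Path A x y (x ∷ ys) × A y z ≡ true
walk⇒path x []       (e , _) = x , stop , e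
walk⇒path x (y ∷ ys) (e , w) with walk⇒path y ys w
... | t , p , e′ = t , e ◅ p , e′

path⇒walk : {A : Adj n} {x y z : Fin n} {l : List (Fin n)} → Path A x y l → A y z ≡ true →
            ∃ λ ys → l ≡ x ∷ ys × Walk A (x ∷ ys ++ [ z ])
path⇒walk stop e = [] , refl , e , tt
path⇒walk (d ◅ p) e with path⇒walk p e
... | ys , refl , w = _ , refl , d , w

isCycle⇒cycle : {A : Adj n} {l : List (Fin n)} → IsCycle A l → Cycle A l
isCycle⇒cycle (3≤ , x , ys , refl , w) with walk⇒path x ys w
... | _ , p , e = cycle p e 3≤

cycle⇒isCycle : {A : Adj n} {l : List (Fin n)} → Cycle A l → IsCycle A l
cycle⇒isCycle (cycle p e 3≤) with path⇒walk p e
... | ys , eq , w = 3≤ , _ , ys , eq , w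

-- The case `at-source` stands apart because nothing precedes `z` there. In the other case the edge
-- at the cut is recorded, since a rotation needs it.
data Splits {V : Set} (A : V → V → Bool) (x y z : V) : List V → Set where
  at-source : ∀ {l} → Path A z y l → z ≡ x → Splits A x y z l
  inside    : ∀ {w l₁ l₂} → Path A x w l₁ → A w z ≡ true → Path A z y l₂ → Splits A x y z (l₁ ++ l₂)

path-split : {A : V → V → Bool} {x y z : V} {l : List V} → Path A x y l → z ∈ l → Splits A x y z l
path-split stop    (here refl) = at-source stop refl
path-split (d ◅ p) (here refl) = at-source (d ◅ p) refl
path-split (d ◅ p) (there z∈l) with path-split p z∈l
... | at-source q refl = inside stop d q
... | inside p₁ e p₂   = inside (d ◅ p₁) e p₂

path-head : {A : V → V → Bool} {x y : V} {l : List V} → Path A x y l → ∃ λ l′ → l ≡ x ∷ l′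
path-head stop    = _ , refl
path-head (_ ◅ _) = _ , refl

cycle-rotate : {A : V → V → Bool} {z : V} {l : List V} → Cycle A l → z ∈ l →
               ∃ λ l′ → Cycle A (z ∷ l′) × l ↭ z ∷ l′
cycle-rotate (cycle p e 3≤) z∈l with path-split p z∈l
cycle-rotate (cycle p e 3≤) z∈l | at-source q refl with path-head q
... | l′ , refl = l′ , cycle q e 3≤ , ↭-refl
cycle-rotate (cycle p e 3≤) z∈l | inside {l₁ = l₁} {l₂} p₁ e′ p₂ with path-head p₂
-- The old closing edge now links the two pieces, and the edge at the cut closes the cycle.
... | l′ , refl = l′ ++ l₁ , cycle (path-++ p₂ e p₁) e′ (subst (3 ≤_) (↭-length perm) 3≤) , perm
  where perm = ++-comm l₁ l₂

-- In a cycle rotated to start at `z`, the neighbours are the second and the last vertex. Length at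
-- least 3 places the last one beyond the second, so the two differ.
cycle-neighbours : {A : V → V → Bool} → (∀ i j → A i j ≡ A j i) → ∀ {z l} → Cycle A l → Unique l → z ∈ l →
                   ∃₂ λ a b → A z a ≡ true × A z b ≡ true × Unique (z ∷ a ∷ b ∷ []) ×
                   ∃ λ r → l ↭ z ∷ a ∷ b ∷ r
cycle-neighbours A-sym C u z∈l with cycle-rotate C z∈l
... | _ , cycle (_ ◅ stop) _ (s≤s (s≤s ())) , _
... | _ , cycle {z} {b} (_◅_ {y = a} d (_◅_ {l = l″} d′ p)) e 3≤ , perm
    with ∈-∃++ (target∈ p)
... | l₁ , l₂ , refl = a , b , d , trans (A-sym z b) e , ++-unique⁻ˡ (z ∷ a ∷ b ∷ []) (Unique-resp-↭ perm′ u) , l₁ ++ l₂ , perm′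
  where
    perm′ = ↭-trans perm (prep z (prep a (shift b l₁ l₂)))

-- Added edges and packings of cycles

addEdge-⊇ : (A : Adj n) (u v i j : Fin n) → A i j ≡ true → addEdge A u v i j ≡ true
addEdge-⊇ A u v i j e rewrite e = refl

addEdge-new : (A : Adj n) (u v : Fin n) → addEdge A u v u v ≡ true
addEdge-new A u v with u ≟ u | v ≟ v
... | yes _ | yes _ = ∨-zeroʳ (A u v)
... | no ¬p | _     = contradiction refl ¬p
... | yes _ | no ¬p = contradiction refl ¬p

addEdge-new′ : (A : Adj n) (u v : Fin n) → addEdge A u v v u ≡ true
addEdge-new′ A u v with v ≟ v | u ≟ u
... | yes _ | yes _ = trans (cong (A v u ∨_) (∨-zeroʳ _)) (∨-zeroʳ (A v u))
... | no ¬p | _     = contradiction refl ¬p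
... | yes _ | no ¬p = contradiction refl ¬p

addEdge-elim : (A : Adj n) (u v : Fin n) {i j : Fin n} {P : Set} → addEdge A u v i j ≡ true →
               (A i j ≡ true → P) → (i ≡ u → j ≡ v → P) → (i ≡ v → j ≡ u → P) → P
addEdge-elim A u v {i} {j} e old new new′ with A i j | i ≟ u | j ≟ v | i ≟ v | j ≟ u
addEdge-elim A u v e old new new′ | true  | _ | _ | _ | _ = old refl
addEdge-elim A u v e old new new′ | false | yes p | yes q | _ | _ = new p q
addEdge-elim A u v e old new new′ | false | yes p | no q | yes r | yes s = new′ r s
addEdge-elim A u v e old new new′ | false | no p | _ | yes r | yes s = new′ r s
addEdge-elim A u v () old new new′ | false | yes p | no q | yes r | no s
addEdge-elim A u v () old new new′ | false | yes p | no q | no r | _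
addEdge-elim A u v () old new new′ | false | no p | _ | yes r | no s
addEdge-elim A u v () old new new′ | false | no p | _ | no r | _

addEdge-map : {m : ℕ} {A : Adj n} {B : Adj m} (f : Fin n → Fin m) →
              (∀ i j → A i j ≡ true → B (f i) (f j) ≡ true) → ∀ u v i j →
              addEdge A u v i j ≡ true → addEdge B (f u) (f v) (f i) (f j) ≡ true
addEdge-map {A = A} {B} f hom u v i j e = addEdge-elim A u v e
  (addEdge-⊇ B (f u) (f v) (f i) (f j) ∘ hom i j)
  (λ { refl refl → addEdge-new B (f u) (f v) })
  (λ { refl refl → addEdge-new′ B (f u) (f v) })

addEdge-comm : (A : Adj n) (u v i j : Fin n) → addEdge A u v i j ≡ true → addEdge A v u i j ≡ true
addEdge-comm A u v i j e = addEdge-elim A u v e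
  (addEdge-⊇ A v u i j)
  (λ { refl refl → addEdge-new′ A v u })
  (λ { refl refl → addEdge-new A v u })

-- The single condition `distinct` says three things at once: the avoided list has no repetition,
-- the cycles are disjoint, and they miss that list. A path used as avoided list is therefore a path
-- with distinct vertices, ready to be closed into a further cycle.
record Packing {V : Set} (A : V → V → Bool) (c : ℕ) (avoided : List V) : Set where
  constructor packing
  field
    {cycles}  : List (List V)
    count     : length cycles ≡ c
    areCycles : All (Cycle A) cycles
    distinct  : Unique (avoided ++ concat cycles)

packing-⊆ : {A B : V → V → Bool} → (∀ i j → A i j ≡ true → B i j ≡ true) →
            ∀ {c l} → Packing A c l → Packing B c l
packing-⊆ A⊆B (packing k cs u) =
  packing k (All.map (λ { (cycle p e 3≤) → cycle (path-⊆ A⊆B p) (A⊆B _ _ e) 3≤ }) cs) u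

packing-resp-↭ : {A : V → V → Bool} {c : ℕ} {l l′ : List V} → l ↭ l′ → Packing A c l → Packing A c l′
packing-resp-↭ l↭l′ (packing k cs u) = packing k cs (Unique-resp-↭ (↭-++⁺ʳ _ l↭l′) u)

packing-∷ : {A : V → V → Bool} {c : ℕ} {l : List V} → Cycle A l → Packing A c l → Packing A (suc c) []
packing-∷ C (packing k cs u) = packing (cong suc k) (C ∷ cs) u

packing-drop : {A : V → V → Bool} {c : ℕ} (l {l′} : List V) → Packing A c (l ++ l′) → Packing A c l′
packing-drop l {l′} (packing {cs} k C u) =
  packing k C (++-unique⁻ʳ l (subst Unique (++-assoc l l′ (concat cs)) u))

-- Cycles in one-point unions

-- Every such path contains the root, so this property at any one vertex already provides `c`
-- disjoint cycles that miss the root.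
Reach : ∀ {s} → Adj (suc s) → ℕ → Fin (suc s) → Set
Reach A c x = ∃ λ l → Path A zero x l × Packing A c l

Bounded : Adj n → ℕ → Set
Bounded A c = ∀ cs → All (Cycle A) cs → Unique (concat cs) → length cs ≤ c

Saturates : Adj n → ℕ → Fin n → Fin n → Set
Saturates A c u v = Packing (addEdge A u v) (suc c) []

saturates-comm : (A : Adj n) {c : ℕ} (u v : Fin n) → Saturates A c u v → Saturates A c v u
saturates-comm A u v = packing-⊆ (addEdge-comm A u v)

-- A description of one-point unions that treats both parts alike, whereas `onePointUnion` indexes
-- them differently. Each argument can then be made for the first part and transferred by
-- `glued-swap`.
record Glued {n s₁ s₂ : ℕ} (A : Adj n) (A₁ : Adj (suc s₁)) (A₂ : Adj (suc s₂)) : Set where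
  field
    ι₁         : Fin (suc s₁) → Fin n
    ι₂         : Fin (suc s₂) → Fin n
    injective₁ : ∀ {a b} → ι₁ a ≡ ι₁ b → a ≡ b
    injective₂ : ∀ {a b} → ι₂ a ≡ ι₂ b → a ≡ b
    root       : ι₁ zero ≡ ι₂ zero
    shared     : ∀ {a b} → ι₁ a ≡ ι₂ b → a ≡ zero
    cover      : ∀ x → (∃ λ a → x ≡ ι₁ a) ⊎ (∃ λ b → x ≡ ι₂ b)
    symmetric  : ∀ i j → A i j ≡ A j i
    adjacent₁  : ∀ a b → A (ι₁ a) (ι₁ b) ≡ A₁ a b
    adjacent₂  : ∀ a b → A (ι₂ a) (ι₂ b) ≡ A₂ a b
    separate   : ∀ a b → A (ι₁ a) (ι₂ b) ≡ true → a ≡ zero ⊎ b ≡ zero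

glued-swap : ∀ {s₁ s₂} {A : Adj n} {A₁ : Adj (suc s₁)} {A₂ : Adj (suc s₂)} → Glued A A₁ A₂ → Glued A A₂ A₁
glued-swap G = record
  { ι₁ = ι₂ ; ι₂ = ι₁ ; injective₁ = injective₂ ; injective₂ = injective₁
  ; root = ≡-sym root
  ; shared = λ {b} {a} e → injective₂ (trans (trans e (cong ι₁ (shared (≡-sym e)))) root)
  ; cover = [ inj₂ , inj₁ ]′ ∘ cover
  ; symmetric = symmetric ; adjacent₁ = adjacent₂ ; adjacent₂ = adjacent₁
  ; separate = λ b a e → [ inj₂ , inj₁ ]′ (separate a b (trans (symmetric (ι₁ a) (ι₂ b)) e)) }
  where open Glued G

module OneSide {s₁ s₂ : ℕ} {A : Adj n} {A₁ : Adj (suc s₁)} {A₂ : Adj (suc s₂)} (G : Glued A A₁ A₂) where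
  open Glued G

  hom₁ : ∀ i j → A₁ i j ≡ true → A (ι₁ i) (ι₁ j) ≡ true
  hom₁ i j = trans (adjacent₁ i j)

  hom₂ : ∀ i j → A₂ i j ≡ true → A (ι₂ i) (ι₂ j) ≡ true
  hom₂ i j = trans (adjacent₂ i j)

  -- The parts meet only in the root, and `ys` omits it.
  union-unique : (xs : List (Fin (suc s₁))) (ys : List (Fin (suc s₂))) → Unique xs → Unique (zero ∷ ys) →
                 Unique (map ι₁ xs ++ map ι₂ ys)
  union-unique xs ys u (0∉ys ∷ u′) = Uniqueₚ.++⁺ (Uniqueₚ.map⁺ injective₁ u) (Uniqueₚ.map⁺ injective₂ u′) disjoint
    where
      disjoint : Disjoint (map ι₁ xs) (map ι₂ ys)
      disjoint (v∈₁ , v∈₂) with ∈-map⁻ ι₁ v∈₁ | ∈-map⁻ ι₂ v∈₂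
      ... | a , _ , refl | b , b∈ys , eq = All.lookup 0∉ys b∈ys
        (injective₂ (trans (≡-sym root) (trans (cong ι₁ (≡-sym (shared eq))) eq)))

  -- The first packing may use the root because the second one misses it. `B` and `B₁` leave room
  -- for an edge added within the first part.
  packing-union : {B : Adj n} {B₁ : Adj (suc s₁)} →
                  (∀ i j → B₁ i j ≡ true → B (ι₁ i) (ι₁ j) ≡ true) → (∀ i j → A i j ≡ true → B i j ≡ true) →
                  ∀ {c₁ c₂ l₁ l₂} → Packing B₁ c₁ l₁ → Packing A₂ c₂ (zero ∷ l₂) →
                  Packing B (c₁ + c₂) (map ι₁ l₁ ++ map ι₂ l₂)
  packing-union hom A⊆B {l₁ = l₁} {l₂} (packing {cs₁} k₁ C₁ u₁) (packing {cs₂} k₂ C₂ u₂) = packing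
    (trans (length-++ (map (map ι₁) cs₁)) (cong₂ _+_ (trans (length-map _ cs₁) k₁) (trans (length-map _ cs₂) k₂)))
    (Allₚ.++⁺ (Allₚ.map⁺ (All.map (cycle-map ι₁ hom) C₁))
              (Allₚ.map⁺ (All.map (cycle-map ι₂ (λ i j → A⊆B _ _ ∘ hom₂ i j)) C₂)))
    (Unique-resp-↭ perm (union-unique (l₁ ++ concat cs₁) (l₂ ++ concat cs₂) u₁ u₂))
    where
      open PermutationReasoning
      L₁ = map ι₁ l₁
      L₂ = map ι₂ l₂
      K₁ = concat (map (map ι₁) cs₁)
      K₂ = concat (map (map ι₂) cs₂)
      perm : map ι₁ (l₁ ++ concat cs₁) ++ map ι₂ (l₂ ++ concat cs₂) ↭
             (L₁ ++ L₂) ++ concat (map (map ι₁) cs₁ ++ map (map ι₂) cs₂)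
      perm = begin
        map ι₁ (l₁ ++ concat cs₁) ++ map ι₂ (l₂ ++ concat cs₂)
          ≡⟨ cong₂ _++_ (map-++ ι₁ l₁ (concat cs₁)) (map-++ ι₂ l₂ (concat cs₂)) ⟩
        (L₁ ++ map ι₁ (concat cs₁)) ++ (L₂ ++ map ι₂ (concat cs₂))
          ≡⟨ cong₂ (λ x y → (L₁ ++ x) ++ (L₂ ++ y)) (concat-map cs₁) (concat-map cs₂) ⟨
        (L₁ ++ K₁) ++ (L₂ ++ K₂)   ≡⟨ ++-assoc L₁ K₁ (L₂ ++ K₂) ⟩
        L₁ ++ K₁ ++ L₂ ++ K₂       ↭⟨ ↭-++⁺ˡ L₁ (shifts K₁ L₂) ⟩
        L₁ ++ L₂ ++ K₁ ++ K₂       ≡⟨ ++-assoc L₁ L₂ (K₁ ++ K₂) ⟨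
        (L₁ ++ L₂) ++ K₁ ++ K₂
          ≡⟨ cong ((L₁ ++ L₂) ++_) (concat-++ (map (map ι₁) cs₁) (map (map ι₂) cs₂)) ⟩
        (L₁ ++ L₂) ++ concat (map (map ι₁) cs₁ ++ map (map ι₂) cs₂) ∎

  glued-saturates : ∀ {c₁ c₂} u v → Saturates A₁ c₁ u v → Packing A₂ c₂ (zero ∷ []) →
                    Saturates A (c₁ + c₂) (ι₁ u) (ι₁ v)
  glued-saturates u v = packing-union (addEdge-map {B = A} ι₁ hom₁ u v) (addEdge-⊇ A (ι₁ u) (ι₁ v))

  glued-reach : ∀ {c₁ c₂ x} → Reach A₁ c₁ x → Packing A₂ c₂ (zero ∷ []) →
                ∃ λ l → Path A (ι₁ zero) (ι₁ x) l × Packing A (c₁ + c₂) l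
  glued-reach (l , p , P) Q = map ι₁ l , path-map ι₁ hom₁ p ,
    subst (Packing A _) (++-identityʳ (map ι₁ l)) (packing-union hom₁ (λ _ _ → id) P Q)

  glued-saturates-across : (∀ i j → A₂ i j ≡ A₂ j i) → ∀ {c₁ c₂ a b} → a ≢ zero → b ≢ zero →
                           Reach A₁ c₁ a → Reach A₂ c₂ b → Saturates A (c₁ + c₂) (ι₁ a) (ι₂ b)
  glued-saturates-across A₂-sym a≢0 b≢0 (_ , stop , P₁) R₂ = contradiction refl a≢0
  glued-saturates-across A₂-sym a≢0 b≢0 (_ , _ ◅ _ , P₁) (_ , stop , P₂) = contradiction refl b≢0
  glued-saturates-across A₂-sym {a = a} {b} a≢0 b≢0 (l , p@(_◅_ {l = l₁} _ p′) , P₁) (_ , _◅_ {y = y} {l = l₂} e q , P₂) =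
    packing-∷
      -- From the root to `a`, over the new edge to `b`, and back to `y`, the second vertex of the
      -- other path: stopping there lets the root occur once, and its edge to `y` closes the cycle.
      (cycle (path-++ (path-⊆ A⊆B (path-map ι₁ hom₁ p)) (addEdge-new A (ι₁ a) (ι₂ b)) (path-⊆ A⊆B (path-map ι₂ hom₂ (path-reverse A₂-sym q))))
             (A⊆B _ _ (trans (cong (A (ι₂ y)) root) (hom₂ y zero (trans (A₂-sym y zero) e))))
             long)
      (packing-⊆ A⊆B
        (packing-union hom₁ (λ _ _ → id) P₁ (packing-resp-↭ (prep zero (↭-sym (↭-reverse l₂))) P₂)))
    where
      A⊆B = addEdge-⊇ A (ι₁ a) (ι₂ b)
      nonempty : ∀ {A : Adj n} {x y l} → Path A x y l → 1 ≤ length l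
      nonempty stop    = s≤s z≤n
      nonempty (_ ◅ _) = s≤s z≤n
      long : 3 ≤ length (map ι₁ (zero ∷ l₁) ++ map ι₂ (reverse l₂))
      long = subst (3 ≤_) (≡-sym (length-++ (map ι₁ (zero ∷ l₁))))
        (+-mono-≤ {2} (s≤s (nonempty (path-map {B = A} ι₁ hom₁ p′)))
                  (nonempty (path-map {B = A} ι₂ hom₂ (path-reverse A₂-sym q))))

  Left Right : Fin n → Set
  Left x  = ∃ λ a → x ≡ ι₁ a
  Right x = ∃ λ b → x ≡ ι₂ b

  -- Every edge between the two parts has the root as an end, so a path that misses the root cannot
  -- change sides.
  stays-left : ∀ {x y l} → Path A x y l → All (_≢ ι₁ zero) l → Left x → All Left l
  stays-left stop _ L = L ∷ []
  stays-left (_◅_ {y = y} e p) (x≢0 ∷ l≢0) (a , refl) = (a , refl) ∷ stays-left p l≢0 left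
    where
      left : Left y
      left with cover y
      ... | inj₁ L          = L
      ... | inj₂ (b , refl) with separate a b e
      ... | inj₁ refl = contradiction refl x≢0
      ... | inj₂ refl = zero , ≡-sym root

  pull-list : ∀ {l} → All Left l → ∃ λ l′ → l ≡ map ι₁ l′
  pull-list [] = [] , refl
  pull-list ((a , refl) ∷ L) with pull-list L
  ... | l′ , refl = a ∷ l′ , refl

  pull-path : ∀ {x y} l → Path A x y (map ι₁ l) → ∃₂ λ a b → x ≡ ι₁ a × y ≡ ι₁ b × Path A₁ a b l
  pull-path (a ∷ [])     stop     = a , a , refl , refl , stop
  pull-path (a ∷ [])     (_ ◅ ())
  pull-path (a ∷ a′ ∷ l) (e ◅ p)  with pull-path (a′ ∷ l) p | path-head p
  ... | a″ , b , refl , refl , q | _ , eq with path-head q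
  ... | _ , refl = a , b , refl , refl , trans (≡-sym (adjacent₁ a a″)) e ◅ q

  pull-cycle : ∀ {l} → Cycle A l → All Left l → ∃ λ l′ → l ≡ map ι₁ l′ × Cycle A₁ l′
  pull-cycle (cycle p e 3≤) L with pull-list L
  ... | l′ , refl with pull-path l′ p
  ... | a , b , refl , refl , q = l′ , refl , cycle q (trans (≡-sym (adjacent₁ b a)) e) (subst (3 ≤_) (length-map ι₁ l′) 3≤)

module _ {s₁ s₂ : ℕ} {A : Adj n} {A₁ : Adj (suc s₁)} {A₂ : Adj (suc s₂)} (G : Glued A A₁ A₂) where
  open Glued G
  private
    module L = OneSide G
    module R = OneSide (glued-swap G)

  one-sided : ∀ {x y l} → Path A x y l → All (_≢ ι₁ zero) l → All L.Left l ⊎ All L.Right l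
  one-sided {x} p l≢0 with cover x
  ... | inj₁ L = inj₁ (L.stays-left p l≢0 L)
  ... | inj₂ R = inj₂ (R.stays-left p (All.map (λ x≢0 eq → x≢0 (trans eq (≡-sym root))) l≢0) R)

  -- A cycle through the root is rotated to start there; the rest of it is a path that misses the
  -- root.
  cycle-one-sided : ∀ {l} → Cycle A l → Unique l → All L.Left l ⊎ All L.Right l
  cycle-one-sided {l} C@(cycle p _ _) u with Any.any? (_≟ ι₁ zero) l
  ... | no 0∉l = one-sided p (Allₚ.¬Any⇒All¬ l 0∉l)
  ... | yes 0∈l with cycle-rotate C (Any.map ≡-sym 0∈l)
  ... | _  , cycle stop _ (s≤s ()) , _
  ... | l′ , cycle (e ◅ q) _ _ , perm with Unique-resp-↭ perm u
  ... | 0∉l′ ∷ _ with one-sided q (All.map (λ 0≢x eq → 0≢x (≡-sym eq)) 0∉l′)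
  ... | inj₁ L = inj₁ (All-resp-↭ (↭-sym perm) ((zero , refl) ∷ L))
  ... | inj₂ R = inj₂ (All-resp-↭ (↭-sym perm) ((zero , root) ∷ R))

  -- The last two fields carry the induction: through them, disjointness of the next cycle from the
  -- others in the union becomes disjointness within its own part.
  record Divided (cs : List (List (Fin n))) : Set where
    field
      left   : List (List (Fin (suc s₁)))
      right  : List (List (Fin (suc s₂)))
      total  : length left + length right ≡ length cs
      leftC  : All (Cycle A₁) left
      rightC : All (Cycle A₂) right
      leftU  : Unique (concat left)
      rightU : Unique (concat right)
      left⊆  : ∀ {x} → x ∈ concat left → ι₁ x ∈ concat cs
      right⊆ : ∀ {x} → x ∈ concat right → ι₂ x ∈ concat cs

  divide : ∀ cs → All (Cycle A) cs → Unique (concat cs) → Divided cs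
  divide [] _ _ = record { left = [] ; right = [] ; total = refl ; leftC = [] ; rightC = []
                         ; leftU = [] ; rightU = [] ; left⊆ = λ () ; right⊆ = λ () }
  divide (l ∷ cs) (C ∷ Cs) u with divide cs Cs (++-unique⁻ʳ l u) | cycle-one-sided C (++-unique⁻ˡ l u)
  ... | D | inj₁ L with L.pull-cycle C L
  ... | l′ , refl , C′ = record
    { left = l′ ∷ left ; right = right ; total = cong suc total ; leftC = C′ ∷ leftC ; rightC = rightC
    ; leftU = Uniqueₚ.++⁺ (Uniqueₚ.map⁻ (++-unique⁻ˡ l u)) leftU
        (λ { (v∈l , v∈left) → ++-disjoint l u (∈-map⁺ ι₁ v∈l , left⊆ v∈left) })
    ; rightU = rightU
    ; left⊆ = λ v∈ → [ ∈-++⁺ˡ ∘ ∈-map⁺ ι₁ , ∈-++⁺ʳ l ∘ left⊆ ]′ (∈-++⁻ l′ v∈)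
    ; right⊆ = ∈-++⁺ʳ l ∘ right⊆ }
    where open Divided D
  divide (l ∷ cs) (C ∷ Cs) u | D | inj₂ R with R.pull-cycle C R
  ... | l′ , refl , C′ = record
    { left = left ; right = l′ ∷ right ; total = trans (+-suc _ _) (cong suc total) ; leftC = leftC ; rightC = C′ ∷ rightC
    ; leftU = leftU
    ; rightU = Uniqueₚ.++⁺ (Uniqueₚ.map⁻ (++-unique⁻ˡ l u)) rightU
        (λ { (v∈l , v∈right) → ++-disjoint l u (∈-map⁺ ι₂ v∈l , right⊆ v∈right) })
    ; left⊆ = ∈-++⁺ʳ l ∘ left⊆
    ; right⊆ = λ v∈ → [ ∈-++⁺ˡ ∘ ∈-map⁺ ι₂ , ∈-++⁺ʳ l ∘ right⊆ ]′ (∈-++⁻ l′ v∈) }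
    where open Divided D

  glued-bounded : ∀ {c₁ c₂} → Bounded A₁ c₁ → Bounded A₂ c₂ → Bounded A (c₁ + c₂)
  glued-bounded b₁ b₂ cs Cs u = subst (_≤ _) total (+-mono-≤ (b₁ left leftC leftU) (b₂ right rightC rightU))
    where open Divided (divide cs Cs u)

-- Counting edges

bit : Bool → ℕ
bit b = if b then 1 else 0

-- Deleting vertex 0 at each step removes the comparison of indices, and a graph obtained by adding
-- a vertex 0 has the right number by computation.
edgeNumber : ∀ {n} → Adj n → ℕ
edgeNumber {zero}  A = 0
edgeNumber {suc n} A = ∑ (λ j → bit (A zero (suc j))) + edgeNumber (λ i j → A (suc i) (suc j))

sum-allFin : (f : Fin n → ℕ) → List.sum (map f (allFin n)) ≡ ∑ f
sum-allFin {n} f = trans (cong List.sum (map-tabulate id f)) (sum-tabulate f)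
  where
    sum-tabulate : ∀ {n} (f : Fin n → ℕ) → List.sum (tabulate f) ≡ ∑ f
    sum-tabulate {zero}  f = refl
    sum-tabulate {suc n} f = cong (f zero +_) (sum-tabulate (f ∘ suc))

∑-const : ∀ n k → ∑ {n} (λ _ → k) ≡ n * k
∑-const zero    k = refl
∑-const (suc n) k = cong (k +_) (∑-const n k)

∑-one : ∀ n → ∑ {n} (λ _ → 1) ≡ n
∑-one n = trans (∑-const n 1) (*-identityʳ n)

edgeCount≡edgeNumber : (G : Graph n) → edgeCount G ≡ edgeNumber (adj G)
edgeCount≡edgeNumber G = trans
  (cong List.sum (map-cong (λ i → sum-allFin (λ j → bit ((toℕ i <ᵇ toℕ j) ∧ adj G i j))) (allFin _)))
  (trans (sum-allFin (λ i → ∑ (λ j → bit ((toℕ i <ᵇ toℕ j) ∧ adj G i j)))) (upper-triangle (adj G)))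
  where
    upper-triangle : ∀ {n} (A : Adj n) → ∑ (λ i → ∑ (λ j → bit ((toℕ i <ᵇ toℕ j) ∧ A i j))) ≡ edgeNumber A
    upper-triangle {zero}  A = refl
    upper-triangle {suc n} A = cong (∑ (λ j → bit (A zero (suc j))) +_) (upper-triangle (λ i j → A (suc i) (suc j)))

edgeNumber-cong : {A B : Adj n} → (∀ i j → A i j ≡ B i j) → edgeNumber A ≡ edgeNumber B
edgeNumber-cong {zero}  eq = refl
edgeNumber-cong {suc n} eq =
  cong₂ _+_ (sum-cong-≗ (λ j → cong bit (eq zero (suc j)))) (edgeNumber-cong (λ i j → eq (suc i) (suc j)))

onSides : Adj m → Adj n → (Fin m → Fin n → Bool) → Fin m ⊎ Fin n → Fin m ⊎ Fin n → Bool
onSides A B X (inj₁ a) (inj₁ b) = A a b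
onSides A B X (inj₁ a) (inj₂ b) = X a b
onSides A B X (inj₂ a) (inj₁ b) = X b a
onSides A B X (inj₂ a) (inj₂ b) = B a b

-- With `X` constantly `false` this is the disjoint union, with `X` constantly `true` the join.
couple : Adj m → Adj n → (Fin m → Fin n → Bool) → Adj (m + n)
couple {m} A B X i j = onSides A B X (splitAt m i) (splitAt m j)

∑-splitAt : ∀ m {n} (h : Fin m ⊎ Fin n → ℕ) → ∑ (h ∘ splitAt m) ≡ ∑ (h ∘ inj₁) + ∑ (h ∘ inj₂)
∑-splitAt zero    h = refl
∑-splitAt (suc m) h = trans
  (cong (h (inj₁ zero) +_) (∑-splitAt m (h ∘ Sum.map₁ suc)))
  (≡-sym (+-assoc (h (inj₁ zero)) _ _))

edgeNumber-couple : (A : Adj m) (B : Adj n) (X : Fin m → Fin n → Bool) →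
                    edgeNumber (couple A B X) ≡ edgeNumber A + edgeNumber B + ∑ (λ i → ∑ (λ j → bit (X i j)))
edgeNumber-couple {zero}  A B X = ≡-sym (+-identityʳ _)
edgeNumber-couple {suc m} {n} A B X = trans
  (cong₂ _+_ (trans (sum-cong-≗ {m + n} (λ j → row (splitAt m j)))
                    (∑-splitAt m [ (λ j → bit (A zero (suc j))) , (λ j → bit (X zero j)) ]′))
             (trans (edgeNumber-cong {m + n} (λ i j → rest (splitAt m i) (splitAt m j)))
                    (edgeNumber-couple A′ B (X ∘ suc))))
  (regroup (∑ (λ j → bit (A zero (suc j)))) (∑ (λ j → bit (X zero j))) (edgeNumber A′) (edgeNumber B)
         (∑ (λ i → ∑ (λ j → bit (X (suc i) j)))))
  where
    regroup : ∀ a x e b y → (a + x) + ((e + b) + y) ≡ ((a + e) + b) + (x + y)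
    regroup = solve-∀
    A′ : Adj m
    A′ i j = A (suc i) (suc j)
    row : (z : Fin m ⊎ Fin n) → bit (onSides A B X (inj₁ zero) (Sum.map₁ suc z)) ≡
          [ (λ j → bit (A zero (suc j))) , (λ j → bit (X zero j)) ]′ z
    row (inj₁ _) = refl
    row (inj₂ _) = refl
    rest : (y z : Fin m ⊎ Fin n) → onSides A B X (Sum.map₁ suc y) (Sum.map₁ suc z) ≡ onSides A′ B (X ∘ suc) y z
    rest (inj₁ _) (inj₁ _) = refl
    rest (inj₁ _) (inj₂ _) = refl
    rest (inj₂ _) (inj₁ _) = refl
    rest (inj₂ _) (inj₂ _) = refl

-- Block s c e: a graph with root 0, s further vertices and e edges, saturated for c + 1 disjoint cycles.
record Block (s c e : ℕ) : Set where
  field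
    graph     : Graph (suc s)
    edges     : edgeNumber (adj graph) ≡ e
    bounded   : Bounded (adj graph) c
    saturates : ∀ u v → u ≢ v → adj graph u v ≡ false → Saturates (adj graph) c u v
    reach     : ∀ x → Reach (adj graph) c x

reach⇒rootless : ∀ {s c x} {A : Adj (suc s)} → Reach A c x → Packing A c [ zero ]
reach⇒rootless (_ , p , P) with path-head p
... | l , refl = packing-drop l (packing-resp-↭ (++-comm [ zero ] l) P)

block⇒saturated : ∀ {s c e} (b : Block s c e) → Saturated (suc c) (Block.graph b)
block⇒saturated {c = c} b = none , λ u v u≢v uv∉ → vec (saturates u v u≢v uv∉)
  where
    open Block b
    none : ¬ HasKDisjointCycles (adj graph) (suc c)
    none (cs , Cs , u) = <⇒≱ (≤-reflexive (≡-sym (length-toList cs))) (bounded (toList cs) (All.map isCycle⇒cycle Cs) u)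
    vec : ∀ {A k} → Packing A k [] → HasKDisjointCycles A k
    vec (packing {cs} refl Cs u) = fromList cs ,
      subst (λ cs → All (IsCycle _) cs × Unique (concat cs)) (≡-sym (toList∘fromList cs)) (All.map cycle⇒isCycle Cs , u)

-- Construction of one-point unions

cone : (Fin n → Bool) → Adj n → Adj (suc n)
cone r A zero    zero    = false
cone r A zero    (suc j) = r j
cone r A (suc i) zero    = r i
cone r A (suc i) (suc j) = A i j

cone-sym : (r : Fin n → Bool) {A : Adj n} → (∀ i j → A i j ≡ A j i) → ∀ i j → cone r A i j ≡ cone r A j i
cone-sym r A-sym zero    zero    = refl
cone-sym r A-sym zero    (suc j) = refl
cone-sym r A-sym (suc i) zero    = refl
cone-sym r A-sym (suc i) (suc j) = A-sym i j

cone-irrefl : (r : Fin n → Bool) {A : Adj n} → (∀ i → A i i ≡ false) → ∀ i → cone r A i i ≡ false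
cone-irrefl r A-irrefl zero    = refl
cone-irrefl r A-irrefl (suc i) = A-irrefl i

couple-sym : {A : Adj m} {B : Adj n} {X : Fin m → Fin n → Bool} → (∀ i j → A i j ≡ A j i) → (∀ i j → B i j ≡ B j i) →
             ∀ i j → couple A B X i j ≡ couple A B X j i
couple-sym {m} {A = A} {B} {X} A-sym B-sym i j = by-sides (splitAt m i) (splitAt m j)
  where
    by-sides : ∀ y z → onSides A B X y z ≡ onSides A B X z y
    by-sides (inj₁ a) (inj₁ b) = A-sym a b
    by-sides (inj₁ a) (inj₂ b) = refl
    by-sides (inj₂ a) (inj₁ b) = refl
    by-sides (inj₂ a) (inj₂ b) = B-sym a b

couple-irrefl : {A : Adj m} {B : Adj n} {X : Fin m → Fin n → Bool} → (∀ i → A i i ≡ false) → (∀ i → B i i ≡ false) →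
                ∀ i → couple A B X i i ≡ false
couple-irrefl {m} A-irrefl B-irrefl i with splitAt m i
... | inj₁ a = A-irrefl a
... | inj₂ b = B-irrefl b

unrooted : Adj (suc n) → Adj n
unrooted A i j = A (suc i) (suc j)

data FromSide (m n : ℕ) : Fin (m + n) → Set where
  left  : ∀ a → FromSide m n (a ↑ˡ n)
  right : ∀ b → FromSide m n (m ↑ʳ b)

fromSide : ∀ m {n} (i : Fin (m + n)) → FromSide m n i
fromSide m {n} i with splitAt m i | join-splitAt m n i
... | inj₁ a | refl = left a
... | inj₂ b | refl = right b

module _ {s₁ s₂ : ℕ} (G₁ : Graph (suc s₁)) (G₂ : Graph (suc s₂)) where
  private
    A₁ = adj G₁
    A₂ = adj G₂

  sides : Adj (s₁ + s₂)
  sides = couple (unrooted A₁) (unrooted A₂) (λ _ _ → false)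

  rootEdges : Fin (s₁ + s₂) → Bool
  rootEdges = [ A₁ zero ∘ suc , A₂ zero ∘ suc ]′ ∘ splitAt s₁

  onePointUnion : Graph (suc (s₁ + s₂))
  onePointUnion = record
    { adj    = cone rootEdges sides
    ; sym    = cone-sym rootEdges (couple-sym (λ i j → sym G₁ (suc i) (suc j)) (λ i j → sym G₂ (suc i) (suc j)))
    ; irrefl = cone-irrefl rootEdges (couple-irrefl (λ i → irrefl G₁ (suc i)) (λ i → irrefl G₂ (suc i))) }

  private
    ι₁ : Fin (suc s₁) → Fin (suc (s₁ + s₂))
    ι₁ i = i ↑ˡ s₂
    ι₂ : Fin (suc s₂) → Fin (suc (s₁ + s₂))
    ι₂ zero    = zero
    ι₂ (suc j) = suc (s₁ ↑ʳ j)

    disjoint : ∀ a b → a ↑ˡ s₂ ≢ s₁ ↑ʳ b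
    disjoint a b eq with trans (≡-sym (splitAt-↑ˡ s₁ a s₂)) (trans (cong (splitAt s₁) eq) (splitAt-↑ʳ s₁ s₂ b))
    ... | ()

    injective₂ : ∀ {a b} → ι₂ a ≡ ι₂ b → a ≡ b
    injective₂ {zero}  {zero}  _  = refl
    injective₂ {suc a} {suc b} eq = cong suc (↑ʳ-injective s₁ a b (suc-injective eq))

    shared : ∀ {a b} → ι₁ a ≡ ι₂ b → a ≡ zero
    shared {zero}          _  = refl
    shared {suc a} {suc b} eq = contradiction (suc-injective eq) (disjoint a b)

    cover : ∀ x → (∃ λ a → x ≡ ι₁ a) ⊎ (∃ λ b → x ≡ ι₂ b)
    cover zero    = inj₁ (zero , refl)
    cover (suc i) with fromSide s₁ i
    ... | left a  = inj₁ (suc a , refl)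
    ... | right b = inj₂ (suc b , refl)

    A = adj onePointUnion

    adjacent₁ : ∀ a b → A (ι₁ a) (ι₁ b) ≡ A₁ a b
    adjacent₁ zero    zero    = ≡-sym (irrefl G₁ zero)
    adjacent₁ zero    (suc b) rewrite splitAt-↑ˡ s₁ b s₂ = refl
    adjacent₁ (suc a) zero    rewrite splitAt-↑ˡ s₁ a s₂ = sym G₁ zero (suc a)
    adjacent₁ (suc a) (suc b) rewrite splitAt-↑ˡ s₁ a s₂ | splitAt-↑ˡ s₁ b s₂ = refl

    adjacent₂ : ∀ a b → A (ι₂ a) (ι₂ b) ≡ A₂ a b
    adjacent₂ zero    zero    = ≡-sym (irrefl G₂ zero)
    adjacent₂ zero    (suc b) rewrite splitAt-↑ʳ s₁ s₂ b = refl
    adjacent₂ (suc a) zero    rewrite splitAt-↑ʳ s₁ s₂ a = sym G₂ zero (suc a)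
    adjacent₂ (suc a) (suc b) rewrite splitAt-↑ʳ s₁ s₂ a | splitAt-↑ʳ s₁ s₂ b = refl

    separate : ∀ a b → A (ι₁ a) (ι₂ b) ≡ true → a ≡ zero ⊎ b ≡ zero
    separate zero    b       _ = inj₁ refl
    separate (suc a) zero    _ = inj₂ refl
    separate (suc a) (suc b) e rewrite splitAt-↑ˡ s₁ a s₂ | splitAt-↑ʳ s₁ s₂ b with () ← e

  onePointUnion-glued : Glued A A₁ A₂
  onePointUnion-glued = record
    { ι₁ = ι₁ ; ι₂ = ι₂ ; injective₁ = ↑ˡ-injective s₂ _ _ ; injective₂ = injective₂ ; root = refl
    ; shared = λ {a} {b} → shared {a} {b} ; cover = cover ; symmetric = sym onePointUnion
    ; adjacent₁ = adjacent₁ ; adjacent₂ = adjacent₂ ; separate = separate }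

  onePointUnion-edges : edgeNumber A ≡ edgeNumber A₁ + edgeNumber A₂
  onePointUnion-edges = trans (cong₂ _+_
    (∑-splitAt s₁ (bit ∘ [ A₁ zero ∘ suc , A₂ zero ∘ suc ]′))
    (trans (edgeNumber-couple (unrooted A₁) (unrooted A₂) (λ _ _ → false))
           (cong (edgeNumber (unrooted A₁) + edgeNumber (unrooted A₂) +_) no-cross)))
    (regroup (∑ (bit ∘ A₁ zero ∘ suc)) (∑ (bit ∘ A₂ zero ∘ suc)) (edgeNumber (unrooted A₁)) (edgeNumber (unrooted A₂)))
    where
      regroup : ∀ r₁ r₂ e₁ e₂ → (r₁ + r₂) + ((e₁ + e₂) + 0) ≡ (r₁ + e₁) + (r₂ + e₂)
      regroup = solve-∀
      no-cross : ∑ {s₁} (λ i → ∑ {s₂} (λ j → 0)) ≡ 0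
      no-cross = trans (sum-cong-≗ {s₁} (λ _ → sum-replicate-zero s₂)) (sum-replicate-zero s₁)

glue : ∀ {s₁ s₂ c₁ c₂ e₁ e₂} → Block s₁ c₁ e₁ → Block s₂ c₂ e₂ → Block (s₁ + s₂) (c₁ + c₂) (e₁ + e₂)
glue {s₁} {s₂} {c₁} {c₂} b₁ b₂ = record
  { graph     = onePointUnion B₁.graph B₂.graph
  ; edges     = trans (onePointUnion-edges B₁.graph B₂.graph) (cong₂ _+_ B₁.edges B₂.edges)
  ; bounded   = glued-bounded glued B₁.bounded B₂.bounded
  ; saturates = saturates
  ; reach     = reach }
  where
    module B₁ = Block b₁
    module B₂ = Block b₂
    glued = onePointUnion-glued B₁.graph B₂.graph
    module L = OneSide glued
    module R = OneSide (glued-swap glued)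
    open Glued glued
    A = adj (onePointUnion B₁.graph B₂.graph)
    P₁ = reach⇒rootless (B₁.reach zero)
    P₂ = reach⇒rootless (B₂.reach zero)

    flip-count : ∀ {x y} → Saturates A (c₂ + c₁) x y → Saturates A (c₁ + c₂) x y
    flip-count {x} {y} = subst (λ c → Saturates A c x y) (+-comm c₂ c₁)

    across : ∀ a b → ι₁ a ≢ ι₂ b → A (ι₁ a) (ι₂ b) ≡ false → Saturates A (c₁ + c₂) (ι₁ a) (ι₂ b)
    -- If one end is the root, the new edge lies within the part of the other end, and that part
    -- alone gains a cycle.
    across zero    b       a≢b e = flip-count (R.glued-saturates zero b (B₂.saturates zero b
      (λ 0≡b → a≢b (trans root (cong ι₂ 0≡b))) (trans (≡-sym (adjacent₂ zero b)) e)) P₁)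
    across (suc a) zero    a≢b e = L.glued-saturates (suc a) zero (B₁.saturates (suc a) zero
      (λ ()) (trans (≡-sym (adjacent₁ (suc a) zero)) e)) P₂
    across (suc a) (suc b) a≢b e = L.glued-saturates-across (sym B₂.graph) (λ ()) (λ ()) (B₁.reach (suc a)) (B₂.reach (suc b))

    saturates : ∀ u v → u ≢ v → A u v ≡ false → Saturates A (c₁ + c₂) u v
    saturates u v u≢v e with cover u | cover v
    ... | inj₁ (a , refl) | inj₁ (b , refl) =
      L.glued-saturates a b (B₁.saturates a b (u≢v ∘ cong ι₁) (trans (≡-sym (adjacent₁ a b)) e)) P₂
    ... | inj₁ (a , refl) | inj₂ (b , refl) = across a b u≢v e
    ... | inj₂ (a , refl) | inj₁ (b , refl) =
      saturates-comm A (ι₁ b) (ι₂ a) (across b a (u≢v ∘ ≡-sym) (trans (symmetric (ι₁ b) (ι₂ a)) e))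
    ... | inj₂ (a , refl) | inj₂ (b , refl) =
      flip-count (R.glued-saturates a b (B₂.saturates a b (u≢v ∘ cong ι₂) (trans (≡-sym (adjacent₂ a b)) e)) P₁)

    reach : ∀ x → Reach A (c₁ + c₂) x
    reach x with cover x
    ... | inj₁ (a , refl) = L.glued-reach (B₁.reach a) P₂
    ... | inj₂ (b , refl) with R.glued-reach (B₂.reach b) P₁
    ... | l , p , P = l , p , subst (λ c → Packing A c l) (+-comm c₂ c₁) P

-- Weightings

weight : (Fin n → ℕ) → List (Fin n) → ℕ
weight w l = List.sum (map w l)

weight-++ : (w : Fin n → ℕ) (l l′ : List (Fin n)) → weight w (l ++ l′) ≡ weight w l + weight w l′
weight-++ w l l′ = trans (cong List.sum (map-++ w l l′)) (sum-++ (map w l) (map w l′))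

weight-↭ : (w : Fin n → ℕ) {l l′ : List (Fin n)} → l ↭ l′ → weight w l ≡ weight w l′
weight-↭ w perm = sum-↭ (↭-map⁺ w perm)

weight-⊆ : (w : Fin n → ℕ) {l l′ : List (Fin n)} → Unique l → (∀ {x} → x ∈ l → x ∈ l′) → weight w l ≤ weight w l′
weight-⊆ w {[]} _ _ = z≤n
weight-⊆ w {x ∷ l} (x∉l ∷ u) l⊆ with ∈-∃++ (l⊆ (here refl))
... | l₁ , l₂ , refl = ≤-trans (+-monoʳ-≤ (w x) (weight-⊆ w u rest⊆)) (≤-reflexive (≡-sym (weight-↭ w perm)))
  where
    perm = shift x l₁ l₂
    rest⊆ : ∀ {y} → y ∈ l → y ∈ l₁ ++ l₂
    rest⊆ y∈l with ∈-resp-↭ perm (l⊆ (there y∈l))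
    ... | here refl = contradiction refl (All.lookup x∉l y∈l)
    ... | there y∈  = y∈

weight-total : (w : Fin n → ℕ) {l : List (Fin n)} → Unique l → weight w l ≤ ∑ w
weight-total w u = ≤-trans (weight-⊆ w u (λ {x} _ → ∈-allFin x)) (≤-reflexive (sum-allFin w))

length≤weight : (w : Fin n → ℕ) {l : List (Fin n)} → All (λ v → w v ≢ 0) l → length l ≤ weight w l
length≤weight w []         = z≤n
length≤weight w (pos ∷ ps) = +-mono-≤ (n≢0⇒n>0 pos) (length≤weight w ps)

-- A weighting that bounds the number of disjoint cycles by c, because every cycle has weight at least q.
record Weighting (A : Adj n) (c : ℕ) : Set where
  field
    w      : Fin n → ℕ
    q      : ℕ
    q≤3    : q ≤ 3
    light  : ∀ v → w v ≡ 0 → ∀ a b → a ≢ b → A v a ≡ true → A v b ≡ true → q ≤ w a + w b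
    total  : ∑ w < q * suc c

module _ {A : Adj n} (A-sym : ∀ i j → A i j ≡ A j i) {c : ℕ} (wt : Weighting A c) where
  open Weighting wt

  -- At a vertex of weight 0 its two neighbours on the cycle already weigh q; otherwise the weight is at least
  -- the length, which is at least 3.
  cycle-weight : ∀ {l} → Cycle A l → Unique l → q ≤ weight w l
  cycle-weight {l} C@(cycle _ _ 3≤) u with Any.any? (λ v → w v N.≟ 0) l
  ... | no ¬light = ≤-trans q≤3 (≤-trans 3≤ (length≤weight w (Allₚ.¬Any⇒All¬ l ¬light)))
  ... | yes some with find some
  ... | v , v∈l , wv≡0 with cycle-neighbours A-sym C u v∈l
  ... | a , b , va , vb , _ ∷ (a≢b ∷ _) ∷ _ , r , perm = begin
    q                                   ≤⟨ light v wv≡0 a b a≢b va vb ⟩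
    w a + w b                           ≤⟨ m≤m+n (w a + w b) (weight w r) ⟩
    w a + w b + weight w r              ≡⟨ +-assoc (w a) (w b) _ ⟩
    w a + (w b + weight w r)            ≤⟨ m≤n+m _ (w v) ⟩
    w v + (w a + (w b + weight w r))    ≡⟨ weight-↭ w perm ⟨
    weight w l                          ∎
    where open ≤-Reasoning

  cycles-weight : ∀ cs → All (Cycle A) cs → Unique (concat cs) → q * length cs ≤ weight w (concat cs)
  cycles-weight []       _        _ = ≤-reflexive (*-zeroʳ q)
  cycles-weight (l ∷ cs) (C ∷ Cs) u = begin
    q * suc (length cs)                ≡⟨ *-suc q (length cs) ⟩
    q + q * length cs                  ≤⟨ +-mono-≤ (cycle-weight C (++-unique⁻ˡ l u)) (cycles-weight cs Cs (++-unique⁻ʳ l u)) ⟩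
    weight w l + weight w (concat cs)  ≡⟨ weight-++ w l (concat cs) ⟨
    weight w (l ++ concat cs)          ∎
    where open ≤-Reasoning

  weighting⇒bounded : Bounded A c
  weighting⇒bounded cs Cs u = s≤s⁻¹ (*-cancelˡ-< q (length cs) (suc c)
    (≤-<-trans (≤-trans (cycles-weight cs Cs u) (weight-total w u)) total))

-- Blocks

complete : ∀ n → Graph n
complete n = record { adj = λ i j → not ⌊ i ≟ j ⌋ ; sym = symmetric ; irrefl = irreflexive }
  where
    symmetric : ∀ (i j : Fin n) → not ⌊ i ≟ j ⌋ ≡ not ⌊ j ≟ i ⌋
    symmetric i j with i ≟ j | j ≟ i
    ... | yes _   | yes _   = refl
    ... | no _    | no _    = refl
    ... | yes i≡j | no j≢i  = contradiction (≡-sym i≡j) j≢i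
    ... | no i≢j  | yes j≡i = contradiction (≡-sym j≡i) i≢j
    irreflexive : ∀ (i : Fin n) → not ⌊ i ≟ i ⌋ ≡ false
    irreflexive i with i ≟ i
    ... | yes _  = refl
    ... | no i≢i = contradiction refl i≢i

complete-adjacent : {i j : Fin n} → i ≢ j → adj (complete n) i j ≡ true
complete-adjacent {i = i} {j} i≢j with i ≟ j
... | yes i≡j = contradiction i≡j i≢j
... | no _    = refl

-- Verification of packings in fixed graphs

path? : (A : Adj n) (x y : Fin n) (l : List (Fin n)) → Dec (Path A x y l)
path? A x y []      = no λ ()
path? A x y (z ∷ []) = map′ (λ { (refl , refl) → stop }) (λ { stop → refl , refl ; (_ ◅ ()) }) ((x ≟ z) ×-dec (y ≟ z))
path? A x y (z ∷ t ∷ l) = map′ (λ { (refl , e , p) → e ◅ p }) step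
  ((x ≟ z) ×-dec ((A x t ≟ᵇ true) ×-dec path? A t y (t ∷ l)))
  where
    step : Path A x y (z ∷ t ∷ l) → x ≡ z × A x t ≡ true × Path A t y (t ∷ l)
    step (e ◅ p) with path-head p
    ... | _ , refl = refl , e , p

walk? : (A : Adj n) (l : List (Fin n)) → Dec (Walk A l)
walk? A []          = yes tt
walk? A (x ∷ [])    = yes tt
walk? A (x ∷ y ∷ l) = (A x y ≟ᵇ true) ×-dec walk? A (y ∷ l)

cycle? : (A : Adj n) (l : List (Fin n)) → Dec (Cycle A l)
cycle? A []      = no λ { (cycle _ _ ()) }
cycle? A (x ∷ l) = map′ (λ { (3≤ , w) → isCycle⇒cycle (3≤ , x , l , refl , w) })
  (λ C → let 3≤ , w = isCycle C in 3≤ , w)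
  ((3 N.≤? length (x ∷ l)) ×-dec walk? A (x ∷ l ++ [ x ]))
  where
    isCycle : Cycle A (x ∷ l) → 3 ≤ length (x ∷ l) × Walk A (x ∷ l ++ [ x ])
    isCycle C with cycle⇒isCycle C
    ... | 3≤ , _ , _ , refl , w = 3≤ , w

-- With the cycles given explicitly the conditions become decidable, so tables of witnesses can be
-- checked by evaluation.
IsPacking : Adj n → ℕ → List (Fin n) → List (List (Fin n)) → Set
IsPacking A c l cs = length cs ≡ c × All (Cycle A) cs × Unique (l ++ concat cs)

isPacking? : (A : Adj n) (c : ℕ) (l : List (Fin n)) (cs : List (List (Fin n))) → Dec (IsPacking A c l cs)
isPacking? A c l cs = (length cs N.≟ c) ×-dec (All.all? (cycle? A) cs ×-dec Unique?.unique? _≟_ (l ++ concat cs))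

module _ {s : ℕ} (A : Adj (suc s)) (c : ℕ) where

  Routes : (Fin (suc s) → List (Fin (suc s)) × List (List (Fin (suc s)))) → Set
  Routes r = ∀ x → Path A zero x (proj₁ (r x)) × IsPacking A c (proj₁ (r x)) (proj₂ (r x))

  routes? : ∀ r → Dec (Routes r)
  routes? r = all? λ x → path? A zero x (proj₁ (r x)) ×-dec isPacking? A c (proj₁ (r x)) (proj₂ (r x))

  routes⇒reach : ∀ {r} → Routes r → ∀ x → Reach A c x
  routes⇒reach R x with R x
  ... | p , k , Cs , u = _ , p , packing k Cs u

  Chords : (Fin (suc s) → Fin (suc s) → List (List (Fin (suc s)))) → Set
  Chords d = ∀ u v → u ≢ v → A u v ≡ false → IsPacking (addEdge A u v) (suc c) [] (d u v)

  chords? : ∀ d → Dec (Chords d)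
  chords? d = all? λ u → all? λ v → ¬? (u ≟ v) →-dec ((A u v ≟ᵇ false) →-dec isPacking? (addEdge A u v) (suc c) [] (d u v))

  chords⇒saturates : ∀ {d} → Chords d → ∀ u v → u ≢ v → A u v ≡ false → Saturates A c u v
  chords⇒saturates D u v u≢v e with D u v u≢v e
  ... | k , Cs , U = packing k Cs U

-- There is one vertex too few for `suc c` triangles.
complete-weighting : ∀ c → Weighting (adj (complete (2 + 3 * c))) c
complete-weighting c = record
  { w = λ _ → 1 ; q = 3 ; q≤3 = ≤-refl ; light = λ _ ()
  ; total = ≤-reflexive (trans (cong suc (∑-one (2 + 3 * c))) (≡-sym (*-suc 3 c))) }

complete-block : ∀ c r → Routes (adj (complete (2 + 3 * c))) c r → Block (1 + 3 * c) c (edgeNumber (adj (complete (2 + 3 * c))))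
complete-block c r R = record
  { graph = K ; edges = refl ; bounded = weighting⇒bounded (sym K) (complete-weighting c)
  ; saturates = λ u v u≢v e → contradiction (trans (≡-sym e) (complete-adjacent u≢v)) λ ()
  ; reach = routes⇒reach (adj K) c {r} R }
  where K = complete (2 + 3 * c)

pendant : Block 1 0 1
pendant = complete-block 0 r (from-yes (routes? (adj (complete 2)) 0 r))
  where
    r : Fin 2 → List (Fin 2) × List (List (Fin 2))
    r 0F = 0F ∷ [] , []
    r 1F = 0F ∷ 1F ∷ [] , []

K₅ : Block 4 1 10
K₅ = complete-block 1 r (from-yes (routes? (adj (complete 5)) 1 r))
  where
    r : Fin 5 → List (Fin 5) × List (List (Fin 5))
    r 0F = 0F ∷ []      , (1F ∷ 2F ∷ 3F ∷ []) ∷ []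
    r 1F = 0F ∷ 1F ∷ [] , (2F ∷ 3F ∷ 4F ∷ []) ∷ []
    r 2F = 0F ∷ 2F ∷ [] , (1F ∷ 3F ∷ 4F ∷ []) ∷ []
    r 3F = 0F ∷ 3F ∷ [] , (1F ∷ 2F ∷ 4F ∷ []) ∷ []
    r 4F = 0F ∷ 4F ∷ [] , (1F ∷ 2F ∷ 3F ∷ []) ∷ []

cast : ∀ {s s′ c c′ e e′} → s ≡ s′ → c ≡ c′ → e ≡ e′ → Block s c e → Block s′ c′ e′
cast refl refl refl b = b

attach : ∀ {s c e s′ c′ e′} → Block s c e → ∀ p → Block s′ c′ e′ → Block (p * s + s′) (p * c + c′) (p * e + e′)
attach b zero b′ = b′
attach {s} {c} {e} b (suc p) b′ =
  cast (≡-sym (+-assoc s _ _)) (≡-sym (+-assoc c _ _)) (≡-sym (+-assoc e _ _)) (glue b (attach b p b′))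

-- The new vertex takes over the role of the root; the old root becomes vertex 1.
twin : Graph (suc n) → Graph (suc (suc n))
twin G = record
  { adj    = cone (adj G zero) (adj G)
  ; sym    = cone-sym (adj G zero) (sym G)
  ; irrefl = cone-irrefl (adj G zero) (irrefl G) }

-- `rootLight` and `heavy` keep the weighting valid under duplication. The duplicate weighs 0 and
-- sees the neighbours of the root, which are heavy enough; being adjacent to heavy vertices only,
-- it is never a neighbour of a light one. `neighbour` serves the missing edge between root and
-- duplicate.
record Twinnable (s c e d : ℕ) : Set where
  field
    block : Block s c e
  open Block block public
  field
    weighting : Weighting (adj graph) c
    degree    : ∑ (λ j → bit (adj graph zero j)) ≡ d
    neighbour : ∃ λ r → adj graph zero r ≡ true
  open Weighting weighting public
  field
    rootLight : w zero ≡ 0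
    heavy     : ∀ v → adj graph zero v ≡ true → w v ≢ 0

module _ {s c e d : ℕ} (T : Twinnable s c e d) where
  open Twinnable T
  private
    A  = adj graph
    A′ = adj (twin graph)

    root-isolated : ∀ {r} → A zero r ≡ true → r ≢ zero
    root-isolated e refl with () ← trans (≡-sym e) (irrefl graph zero)

    lift : ∀ {A : Adj (suc s)} {B : Adj (suc (suc s))} {c l} → (∀ i j → A i j ≡ true → B (suc i) (suc j) ≡ true) → Packing A c l → Packing B c (zero ∷ map suc l)
    lift {l = l} hom (packing {cs} k Cs u) = packing (trans (length-map _ cs) k)
      (Allₚ.map⁺ (All.map (cycle-map suc hom) Cs))
      (subst (Unique ∘ (zero ∷_)) (trans (map-++ suc l (concat cs)) (cong (map suc l ++_) (≡-sym (concat-map cs))))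
        (Allₚ.map⁺ (All.universal (λ _ ()) _) ∷ Uniqueₚ.map⁺ suc-injective u))

    lift′ : ∀ {c l} → Packing A c l → Packing A′ c (zero ∷ map suc l)
    lift′ = lift {A} {A′} (λ _ _ e → e)

    climb : ∀ {x y l} → Path A x y l → Path A′ (suc x) (suc y) (map suc l)
    climb = path-map {A = A} {A′} suc (λ _ _ e → e)

    dropRoot : ∀ {c l} → Packing A′ c (zero ∷ suc zero ∷ l) → Packing A′ c (zero ∷ l)
    dropRoot P = packing-drop [ suc zero ] (packing-resp-↭ (swap zero (suc zero) ↭-refl) P)

    -- The path x y … r back to the root, where r is a neighbour of the root, becomes a cycle through the new vertex.
    saturates-root : Saturates A′ c zero (suc zero)
    saturates-root with neighbour
    ... | r , 0r with reach r
    ... | _ , stop , _ = contradiction refl (root-isolated 0r)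
    ... | l , p@(_◅_ {l = l₁} d q) , P with path-head q
    ... | l₂ , refl = packing-∷
      (cycle (path-⊆ ⊇ (path-++ (climb p) 0r (stop {x = zero})))
             (addEdge-new A′ zero (suc zero))
             (s≤s (s≤s (nonempty (map suc l₂)))))
      (packing-⊆ ⊇ (packing-resp-↭ (++-comm [ zero ] (map suc l)) (lift′ P)))
      where
        ⊇ = addEdge-⊇ A′ zero (suc zero)
        nonempty : ∀ xs → 1 ≤ length (xs ++ [ zero {suc s} ])
        nonempty []      = s≤s z≤n
        nonempty (_ ∷ _) = s≤s z≤n

    -- The new vertex replaces the root on the path to `v`, and the added edge closes it up. A path
    -- of a single edge would make `v` adjacent to the root.
    saturates-new : ∀ v → A zero (suc v) ≡ false → Saturates A′ c zero (suc (suc v))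
    saturates-new v 0v with reach (suc v)
    ... | _ , d ◅ stop , _ with () ← trans (≡-sym d) 0v
    ... | _ , _◅_ {y = y} d p@(d′ ◅ q) , P with path-head q
    ... | _ , refl = packing-∷
      (cycle (⊇ zero (suc y) d ◅ path-⊆ ⊇ (climb p)) (addEdge-new′ A′ zero (suc (suc v))) (s≤s (s≤s (s≤s z≤n))))
      (packing-⊆ ⊇ (dropRoot (lift′ P)))
      where ⊇ = addEdge-⊇ A′ zero (suc (suc v))

    twin-saturates : ∀ u v → u ≢ v → A′ u v ≡ false → Saturates A′ c u v
    twin-saturates zero          zero          u≢v e = contradiction refl u≢v
    twin-saturates zero          (suc zero)    u≢v e = saturates-root
    twin-saturates zero          (suc (suc v)) u≢v e = saturates-new v e
    twin-saturates (suc zero)    zero          u≢v e = saturates-comm A′ zero (suc zero) saturates-root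
    twin-saturates (suc (suc u)) zero          u≢v e =
      saturates-comm A′ zero (suc (suc u)) (saturates-new u e)
    twin-saturates (suc u)       (suc v)       u≢v e = packing-drop [ zero ]
      (lift {addEdge A u v} {addEdge A′ (suc u) (suc v)} (addEdge-map {A = A} {A′} suc (λ _ _ e → e) u v) (saturates u v (u≢v ∘ cong suc) e))

    twin-reach : ∀ x → Reach A′ c x
    twin-reach zero = [ zero ] , stop , dropRoot (lift′ (reach⇒rootless {x = zero} (reach zero)))
    twin-reach (suc zero) with neighbour
    ... | r , 0r with reach r
    ... | _ , stop , _ = contradiction refl (root-isolated 0r)
    -- The path from the old root to its neighbour `r` now starts at the new vertex, and the edge
    -- from `r` leads on to the old root.
    ... | _ , _◅_ {l = l} d p , P = _ , path-++ (_◅_ {x = zero} d (climb p)) (trans (sym graph r zero) 0r) stop ,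
      packing-resp-↭ (prep zero (++-comm [ suc zero ] (map suc l))) (lift′ P)
    twin-reach (suc (suc x)) with reach (suc x)
    ... | _ , d ◅ p , P = _ , d ◅ climb p , dropRoot (lift′ P)

    w′ : Fin (suc (suc s)) → ℕ
    w′ zero    = 0
    w′ (suc v) = w v

    light′ : ∀ v → w′ v ≡ 0 → ∀ a b → a ≢ b → A′ v a ≡ true → A′ v b ≡ true → q ≤ w′ a + w′ b
    light′ zero    _  (suc a) (suc b) a≢b va vb = light zero rootLight a b (a≢b ∘ cong suc) va vb
    light′ (suc v) v0 zero    b       a≢b va _  = contradiction v0 (heavy v va)
    light′ (suc v) v0 (suc a) zero    a≢b _  vb = contradiction v0 (heavy v vb)
    light′ (suc v) v0 (suc a) (suc b) a≢b va vb = light v v0 a b (a≢b ∘ cong suc) va vb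

    weighting′ : Weighting A′ c
    weighting′ = record { w = w′ ; q = q ; q≤3 = q≤3 ; light = light′ ; total = total }

  twin-twinnable : Twinnable (suc s) c (d + e) d
  twin-twinnable = record
    { block = record
      { graph     = twin graph
      ; edges     = cong₂ _+_ degree edges
      ; bounded   = weighting⇒bounded (sym (twin graph)) weighting′
      ; saturates = twin-saturates
      ; reach     = twin-reach }
    ; weighting = weighting′
    ; degree    = degree
    ; neighbour = suc (proj₁ neighbour) , proj₂ neighbour
    ; rootLight = refl
    ; heavy     = heavy′ }
    where
      heavy′ : ∀ v → A′ zero v ≡ true → w′ v ≢ 0
      heavy′ (suc v) = heavy v

-- K₄ on 1, …, 4 together with 0, 5, 6, each joined to 1 and to one of 2, 3, 4.
base : Graph 7
base = record { adj = A ; sym = from-yes (all? λ i → all? λ j → A i j ≟ᵇ A j i) ; irrefl = from-yes (all? λ i → A i i ≟ᵇ false) }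
  where
    up : Fin 7 → Fin 7 → Bool
    up 0F 1F = true
    up 0F 2F = true
    up 1F 2F = true
    up 1F 3F = true
    up 1F 4F = true
    up 1F 5F = true
    up 1F 6F = true
    up 2F 3F = true
    up 2F 4F = true
    up 3F 4F = true
    up 3F 5F = true
    up 4F 6F = true
    up _  _  = false
    A : Adj 7
    A i j = up i j ∨ up j i

base-twinnable : Twinnable 6 1 12 2
base-twinnable = record
  { block = record
    { graph     = base
    ; edges     = refl
    ; bounded   = weighting⇒bounded (sym base) weighting
    ; saturates = chords⇒saturates (adj base) 1 {chords} (from-yes (chords? (adj base) 1 chords))
    ; reach     = routes⇒reach (adj base) 1 {routes} (from-yes (routes? (adj base) 1 routes)) }
  ; weighting = weighting
  ; degree    = refl
  ; neighbour = 1F , refl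
  ; rootLight = refl
  ; heavy     = from-yes (all? λ v → (adj base 0F v ≟ᵇ true) →-dec ¬? (w v N.≟ 0)) }
  where
    -- The outer vertices 0, 5, 6 weigh nothing and each has neighbours of weights 2 and 1, so every
    -- cycle weighs at least 3; the total 5 is less than twice that.
    w : Fin 7 → ℕ
    w 1F = 2
    w 2F = 1
    w 3F = 1
    w 4F = 1
    w _  = 0

    weighting : Weighting (adj base) 1
    weighting = record
      { w = w ; q = 3 ; q≤3 = ≤-refl ; total = ≤-refl
      ; light = from-yes (all? λ v → (w v N.≟ 0) →-dec all? λ a → all? λ b → ¬? (a ≟ b) →-dec
          ((adj base v a ≟ᵇ true) →-dec ((adj base v b ≟ᵇ true) →-dec (3 N.≤? (w a + w b))))) }

    routes : Fin 7 → List (Fin 7) × List (List (Fin 7))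
    routes 0F = 0F ∷ []                , (1F ∷ 2F ∷ 3F ∷ []) ∷ []
    routes 1F = 0F ∷ 1F ∷ []           , (2F ∷ 3F ∷ 4F ∷ []) ∷ []
    routes 2F = 0F ∷ 2F ∷ []           , (1F ∷ 3F ∷ 5F ∷ []) ∷ []
    routes 3F = 0F ∷ 2F ∷ 3F ∷ []      , (1F ∷ 4F ∷ 6F ∷ []) ∷ []
    routes 4F = 0F ∷ 2F ∷ 4F ∷ []      , (1F ∷ 3F ∷ 5F ∷ []) ∷ []
    routes 5F = 0F ∷ 2F ∷ 3F ∷ 5F ∷ [] , (1F ∷ 4F ∷ 6F ∷ []) ∷ []
    routes 6F = 0F ∷ 2F ∷ 4F ∷ 6F ∷ [] , (1F ∷ 3F ∷ 5F ∷ []) ∷ []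

    chords : Fin 7 → Fin 7 → List (List (Fin 7))
    chords u v = if toℕ u <ᵇ toℕ v then up u v else up v u
      where
        -- The cycle through the new edge uses two of 2, 3, 4; the third of them, its outer vertex
        -- and 1 form the other cycle. The default `[]` is met only by adjacent or equal vertices.
        up : Fin 7 → Fin 7 → List (List (Fin 7))
        up 0F 3F = (0F ∷ 2F ∷ 3F ∷ []) ∷ (1F ∷ 4F ∷ 6F ∷ []) ∷ []
        up 0F 4F = (0F ∷ 2F ∷ 4F ∷ []) ∷ (1F ∷ 3F ∷ 5F ∷ []) ∷ []
        up 0F 5F = (0F ∷ 2F ∷ 3F ∷ 5F ∷ []) ∷ (1F ∷ 4F ∷ 6F ∷ []) ∷ []
        up 0F 6F = (0F ∷ 2F ∷ 4F ∷ 6F ∷ []) ∷ (1F ∷ 3F ∷ 5F ∷ []) ∷ []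
        up 2F 5F = (2F ∷ 3F ∷ 5F ∷ []) ∷ (1F ∷ 4F ∷ 6F ∷ []) ∷ []
        up 2F 6F = (2F ∷ 4F ∷ 6F ∷ []) ∷ (1F ∷ 3F ∷ 5F ∷ []) ∷ []
        up 3F 6F = (3F ∷ 4F ∷ 6F ∷ []) ∷ (0F ∷ 1F ∷ 2F ∷ []) ∷ []
        up 4F 5F = (3F ∷ 4F ∷ 5F ∷ []) ∷ (0F ∷ 1F ∷ 2F ∷ []) ∷ []
        up 5F 6F = (3F ∷ 4F ∷ 6F ∷ 5F ∷ []) ∷ (0F ∷ 1F ∷ 2F ∷ []) ∷ []
        up _  _  = []

twins : ∀ q → Twinnable (q + 6) 1 (q * 2 + 12) 2
twins zero    = base-twinnable
twins (suc q) = twin-twinnable (twins q)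

-- Joins of odd cliques with independent vertices

without : Fin n → List (Fin n) → List (Fin n)
without x = filter (λ y → ¬? (y ≟ x))

length-without : (x : Fin n) {l : List (Fin n)} → Unique l → length l ≤ suc (length (without x l))
length-without x [] = z≤n
length-without x {y ∷ l} (y∉l ∷ u) with y ≟ x
... | no _     = s≤s (length-without x u)
... | yes refl = s≤s (≤-reflexive (cong length (≡-sym (filter-all (λ z → ¬? (z ≟ y)) (All.map (λ y≢z z≡y → y≢z (≡-sym z≡y)) y∉l)))))

edgeNumber-complete-suc : ∀ n → edgeNumber (adj (complete (suc n))) ≡ n + edgeNumber (adj (complete n))
edgeNumber-complete-suc n = cong₂ _+_ (∑-one n) (edgeNumber-cong {n} shift-indices)
  where
    shift-indices : ∀ i j → not ⌊ suc i ≟ suc j ⌋ ≡ not ⌊ i ≟ j ⌋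
    shift-indices i j with i ≟ j
    ... | yes _ = refl
    ... | no _  = refl

edgeNumber-complete : ∀ c → edgeNumber (adj (complete (1 + c * 2))) ≡ c * (1 + c * 2)
edgeNumber-complete zero    = refl
edgeNumber-complete (suc c) = trans (edgeNumber-complete-suc (2 + c * 2))
  (trans (cong (2 + c * 2 +_) (trans (edgeNumber-complete-suc (1 + c * 2)) (cong (1 + c * 2 +_) (edgeNumber-complete c))))
  (regroup c))
  where
    regroup : ∀ c → 2 + c * 2 + (1 + c * 2 + c * (1 + c * 2)) ≡ (1 + c) * (1 + (1 + c) * 2)
    regroup = solve-∀

edgeNumber-empty : ∀ n → edgeNumber {n} (λ _ _ → false) ≡ 0
edgeNumber-empty zero    = refl
edgeNumber-empty (suc n) = cong₂ _+_ (sum-replicate-zero n) (edgeNumber-empty n)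

-- K_{2c+1} joined to 2 + c + d independent vertices, one of which is the root; every cycle uses two vertices
-- of the clique.
module Join (c d : ℕ) where
  t m′ : ℕ
  -- `c` triangles use 2c clique vertices and `c` independent ones. What is left over, one clique
  -- vertex and two independent ones, becomes one more triangle as soon as the latter two are
  -- joined.
  t  = 1 + c * 2
  m′ = 2 + (c + d)

  on : Fin m′ ⊎ Fin t → Fin m′ ⊎ Fin t → Bool
  on = onSides (λ _ _ → false) (adj (complete t)) (λ _ _ → true)

  A : Adj (m′ + t)
  A = couple {m′} (λ _ _ → false) (adj (complete t)) (λ _ _ → true)

  graph : Graph (m′ + t)
  graph = record
    { adj    = A
    ; sym    = couple-sym {m′} {A = λ _ _ → false} {adj (complete t)} {X = λ _ _ → true} (λ _ _ → refl) (sym (complete t))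
    ; irrefl = couple-irrefl {m′} {A = λ _ _ → false} {adj (complete t)} {X = λ _ _ → true} (λ _ → refl) (irrefl (complete t)) }

  independent : Fin m′ → Fin (m′ + t)
  independent i = i ↑ˡ t

  clique : Fin t → Fin (m′ + t)
  clique y = m′ ↑ʳ y

  edges : edgeNumber A ≡ (m′ + c) * t
  edges = trans (edgeNumber-couple {m′} (λ _ _ → false) (adj (complete t)) (λ _ _ → true))
    (trans (cong₂ _+_ (cong₂ _+_ (edgeNumber-empty m′) (edgeNumber-complete c))
                      (trans (sum-cong-≗ {m′} (λ _ → ∑-one t)) (∑-const m′ t)))
           (trans (+-comm (c * t) (m′ * t)) (≡-sym (*-distribʳ-+ t m′ c))))

  independent-clique : ∀ i y → A (independent i) (clique y) ≡ true
  independent-clique i y = cong₂ on (splitAt-↑ˡ m′ i t) (splitAt-↑ʳ m′ t y)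

  clique-independent : ∀ y i → A (clique y) (independent i) ≡ true
  clique-independent y i = trans (sym graph (clique y) (independent i)) (independent-clique i y)

  clique-clique : ∀ y z → y ≢ z → A (clique y) (clique z) ≡ true
  clique-clique y z y≢z = trans (cong₂ on (splitAt-↑ʳ m′ t y) (splitAt-↑ʳ m′ t z)) (complete-adjacent y≢z)

  independent≢clique : ∀ i y → independent i ≢ clique y
  independent≢clique i y eq
    with () ← trans (≡-sym (splitAt-↑ˡ m′ i t)) (trans (cong (splitAt m′) eq) (splitAt-↑ʳ m′ t y))

  -- All neighbours of an independent vertex lie in the clique, so two of them weigh 2, and the
  -- clique has only 2c + 1 vertices.
  weighting : Weighting A c
  weighting = record { w = [ (λ _ → 0) , (λ _ → 1) ]′ ∘ splitAt m′ ; q = 2 ; q≤3 = s≤s (s≤s z≤n) ; light = light ; total = total }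
    where
      light : ∀ v → [ (λ _ → 0) , (λ _ → 1) ]′ (splitAt m′ v) ≡ 0 → ∀ a b → a ≢ b → A v a ≡ true → A v b ≡ true →
              2 ≤ [ (λ _ → 0) , (λ _ → 1) ]′ (splitAt m′ a) + [ (λ _ → 0) , (λ _ → 1) ]′ (splitAt m′ b)
      light v v0 a b _ va vb with splitAt m′ v | splitAt m′ a | splitAt m′ b
      ... | inj₁ _ | inj₂ _ | inj₂ _ = ≤-refl
      light v v0 a b _ () vb | inj₁ _ | inj₁ _ | _
      light v v0 a b _ va () | inj₁ _ | inj₂ _ | inj₁ _
      total : ∑ ([ (λ _ → 0) , (λ _ → 1) ]′ ∘ splitAt m′) < 2 * suc c
      total = ≤-reflexive (trans (cong suc (trans (∑-splitAt m′ {t} [ (λ _ → 0) , (λ _ → 1) ]′)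
        (cong₂ _+_ (sum-replicate-zero m′) (∑-one t))))
        (*-comm (suc c) 2))

  -- `rest` collects the vertices left over. The permutation hands the distinctness of the given
  -- vertices on to the cycles.
  triangles : ∀ k (ys : List (Fin t)) (is : List (Fin m′)) → k * 2 ≤ length ys → k ≤ length is → Unique ys →
              ∃₂ λ cs rest → length cs ≡ k × All (Cycle A) cs ×
                             map clique ys ++ map independent is ↭ concat cs ++ rest
  triangles zero ys is _ _ _ = [] , _ , refl , [] , ↭-refl
  triangles (suc k) (y ∷ z ∷ ys) (i ∷ is) (s≤s (s≤s 2k≤)) (s≤s k≤) ((y≢z ∷ _) ∷ _ ∷ u) with triangles k ys is 2k≤ k≤ u
  ... | cs , rest , count , Cs , perm =
    (clique y ∷ clique z ∷ independent i ∷ []) ∷ cs , rest , cong suc count ,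
    cycle (clique-clique y z y≢z ◅ clique-independent z i ◅ stop) (independent-clique i y) ≤-refl ∷ Cs ,
    prep _ (prep _ (↭-trans (shift (independent i) (map clique ys) (map independent is)) (prep _ perm)))
  triangles (suc k) (_ ∷ []) _ (s≤s ()) _ _

  -- Removing one clique and two independent vertices leaves enough for c triangles.
  spare : ∀ y i j {l} → Unique l → (∀ {v} → v ∈ l → v ∈ clique y ∷ independent i ∷ independent j ∷ []) → Packing A c l
  spare y i j {l} ul l⊆ = result (triangles c ys is enough-ys enough-is u-ys)
    where
      ys = without y (allFin t)
      -- `i` and `j` may coincide, as they do in `reach`; each removal costs at most one vertex.
      is = without i (without j (allFin m′))
      u-ys = Uniqueₚ.filter⁺ (λ z → ¬? (z ≟ y)) (Uniqueₚ.allFin⁺ t)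
      u-js = Uniqueₚ.filter⁺ (λ z → ¬? (z ≟ j)) (Uniqueₚ.allFin⁺ m′)
      u-is = Uniqueₚ.filter⁺ (λ z → ¬? (z ≟ i)) u-js
      enough-ys : c * 2 ≤ length ys
      enough-ys = s≤s⁻¹ (subst (_≤ suc (length ys)) (length-tabulate {n = t} id) (length-without y (Uniqueₚ.allFin⁺ t)))
      enough-is : c ≤ length is
      enough-is = ≤-trans (m≤m+n c d) (s≤s⁻¹ (s≤s⁻¹ (≤-trans
        (subst (_≤ suc (length (without j (allFin m′)))) (length-tabulate {n = m′} id) (length-without j (Uniqueₚ.allFin⁺ m′)))
        (s≤s (length-without i u-js)))))

      free : ∀ {v} → v ∈ map clique ys ++ map independent is → ¬ v ∈ l
      free v∈ v∈l with ∈-++⁻ (map clique ys) v∈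
      ... | inj₁ v∈ys with ∈-map⁻ clique v∈ys
      ... | z , z∈ys , refl with l⊆ v∈l
      ... | here eq                 = proj₂ (∈-filter⁻ (λ z → ¬? (z ≟ y)) {xs = allFin t} z∈ys) (↑ʳ-injective m′ z y eq)
      ... | there (here eq)         = independent≢clique i z (≡-sym eq)
      ... | there (there (here eq)) = independent≢clique j z (≡-sym eq)
      free v∈ v∈l | inj₂ v∈is with ∈-map⁻ independent v∈is
      ... | k , k∈is , refl with ∈-filter⁻ (λ z → ¬? (z ≟ i)) {xs = without j (allFin m′)} k∈is | l⊆ v∈l
      ... | _ , _      | here eq                 = independent≢clique k y eq
      ... | _ , k≢i    | there (here eq)         = k≢i (↑ˡ-injective t k i eq)
      ... | k∈js , _   | there (there (here eq)) =
        proj₂ (∈-filter⁻ (λ z → ¬? (z ≟ j)) {xs = allFin m′} k∈js) (↑ˡ-injective t k j eq)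

      result : (∃₂ λ cs rest → length cs ≡ c × All (Cycle A) cs × map clique ys ++ map independent is ↭ concat cs ++ rest) →
               Packing A c l
      result (cs , rest , count , Cs , perm) = packing count Cs (Uniqueₚ.++⁺ ul
        (++-unique⁻ˡ (concat cs) (Unique-resp-↭ perm
          (Uniqueₚ.++⁺ (Uniqueₚ.map⁺ (λ {a} {b} → ↑ʳ-injective m′ a b) u-ys) (Uniqueₚ.map⁺ (λ {a} {b} → ↑ˡ-injective t a b) u-is) apart)))
        (λ { (v∈l , v∈cs) → free (∈-resp-↭ (↭-sym perm) (∈-++⁺ˡ v∈cs)) v∈l }))
        where
          apart : Disjoint (map clique ys) (map independent is)
          apart (v∈₁ , v∈₂) with ∈-map⁻ clique v∈₁ | ∈-map⁻ independent v∈₂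
          ... | y , _ , refl | i , _ , eq = independent≢clique i y (≡-sym eq)

  reach : ∀ x → Reach A c x
  reach x with fromSide m′ {t} x
  ... | left zero    = [ zero ] , stop , spare zero zero zero ([] ∷ []) (there ∘ ∈-++⁺ˡ)
  ... | left (suc i) = zero ∷ clique zero ∷ independent (suc i) ∷ [] ,
    independent-clique zero zero ◅ clique-independent zero (suc i) ◅ stop ,
    spare zero zero (suc i)
      ((independent≢clique zero zero ∷ (λ ()) ∷ []) ∷ (independent≢clique (suc i) zero ∘ ≡-sym ∷ []) ∷ [] ∷ [])
      (∈-resp-↭ (swap _ _ ↭-refl))
  ... | right y = zero ∷ clique y ∷ [] , independent-clique zero y ◅ stop ,
    spare y zero zero ((independent≢clique zero y ∷ []) ∷ [] ∷ []) (λ v∈ → ∈-++⁺ˡ (∈-resp-↭ (swap _ _ ↭-refl) v∈))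

  saturates : ∀ u v → u ≢ v → A u v ≡ false → Saturates A c u v
  saturates u v u≢v e with fromSide m′ {t} u | fromSide m′ {t} v
  ... | left i  | right y with () ← trans (≡-sym e) (independent-clique i y)
  ... | right y | left i  with () ← trans (≡-sym e) (clique-independent y i)
  ... | right y | right z with () ← trans (≡-sym e) (clique-clique y z (u≢v ∘ cong clique))
  ... | left i  | left j  = packing-∷
    (cycle (⊇ (clique zero) (independent i) (clique-independent zero i) ◅ addEdge-new A (independent i) (independent j) ◅ stop)
           (⊇ (independent j) (clique zero) (independent-clique j zero)) ≤-refl)
    (packing-⊆ ⊇ (spare zero i j
      ((independent≢clique i zero ∘ ≡-sym ∷ independent≢clique j zero ∘ ≡-sym ∷ []) ∷ (u≢v ∷ []) ∷ [] ∷ []) id))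
    where ⊇ = addEdge-⊇ A (independent i) (independent j)

  block : Block (1 + (c + d) + t) c ((m′ + c) * t)
  block = record { graph = graph ; edges = edges ; bounded = weighting⇒bounded (sym graph) weighting
                 ; saturates = saturates ; reach = reach }

-- Combinations of blocks

block⇒inES : ∀ {s c e} → Block s c e → suc s ≡ n → suc c ≡ k → e ≡ m → InES n k m
block⇒inES b refl refl refl = graph , block⇒saturated b , trans (edgeCount≡edgeNumber graph) edges
  where open Block b

cancel-≤ : ∀ z {x y l r} → l ≡ z + x → r ≡ z + y → l ≤ r → x ≤ y
cancel-≤ z refl refl = +-cancelˡ-≤ z _ _

K₅s : ∀ a p → InES (5 + 4 * a + p) (2 + a) (10 + 10 * a + p)
K₅s a p = block⇒inES (attach pendant p (attach K₅ a K₅)) (vertices a p) (cycles a p) (edges a p)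
  where
    vertices : ∀ a p → suc (p * 1 + (a * 4 + 4)) ≡ 5 + 4 * a + p
    vertices = solve-∀
    cycles : ∀ a p → suc (p * 0 + (a * 1 + 1)) ≡ 2 + a
    cycles = solve-∀
    edges : ∀ a p → p * 1 + (a * 10 + 10) ≡ 10 + 10 * a + p
    edges = solve-∀

twins-K₅s : ∀ a q p → InES (7 + 4 * a + q + p) (2 + a) (12 + 10 * a + 2 * q + p)
twins-K₅s a q p = block⇒inES (attach pendant p (attach K₅ a (Twinnable.block (twins q)))) (vertices a q p) (cycles a p) (edges a q p)
  where
    vertices : ∀ a q p → suc (p * 1 + (a * 4 + (q + 6))) ≡ 7 + 4 * a + q + p
    vertices = solve-∀
    cycles : ∀ a p → suc (p * 0 + (a * 1 + 1)) ≡ 2 + a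
    cycles = solve-∀
    edges : ∀ a q p → p * 1 + (a * 10 + (q * 2 + 12)) ≡ 12 + 10 * a + 2 * q + p
    edges = solve-∀

twins-join-K₅s : ∀ a q j p → InES (12 + 4 * a + q + j + p) (3 + a) (24 + 10 * a + 2 * q + 3 * j + p)
twins-join-K₅s a q j p = block⇒inES (attach pendant p (attach K₅ a (glue (Twinnable.block (twins q)) (Join.block 1 j))))
  (vertices a q j p) (cycles a p) (edges a q j p)
  where
    vertices : ∀ a q j p → suc (p * 1 + (a * 4 + (q + 6 + (1 + (1 + j) + 3)))) ≡ 12 + 4 * a + q + j + p
    vertices = solve-∀
    cycles : ∀ a p → suc (p * 0 + (a * 1 + 2)) ≡ 3 + a
    cycles = solve-∀
    edges : ∀ a q j p → p * 1 + (a * 10 + (q * 2 + 12 + (2 + (1 + j) + 1) * 3)) ≡ 24 + 10 * a + 2 * q + 3 * j + p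
    edges = solve-∀

twins-join-join : ∀ c d q j p → InES (14 + 3 * c + d + q + j + p) (3 + c) (24 + 2 * q + 3 * j + (2 + (c + d) + c) * (1 + c * 2) + p)
twins-join-join c d q j p = block⇒inES (attach pendant p (glue (glue (Twinnable.block (twins q)) (Join.block 1 j)) (Join.block c d)))
  (vertices c d q j p) (cycles c p) (edges ((2 + (c + d) + c) * (1 + c * 2)) q j p)
  where
    vertices : ∀ c d q j p → suc (p * 1 + (q + 6 + (1 + (1 + j) + 3) + (1 + (c + d) + (1 + c * 2)))) ≡ 14 + 3 * c + d + q + j + p
    vertices = solve-∀
    cycles : ∀ c p → suc (p * 0 + (2 + c)) ≡ 3 + c
    cycles = solve-∀
    edges : ∀ e q j p → p * 1 + (q * 2 + 12 + (2 + (1 + j) + 1) * 3 + e) ≡ 24 + 2 * q + 3 * j + e + p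
    edges = solve-∀

join-pendants : ∀ c d p → InES (3 + 3 * c + d + p) (1 + c) ((2 + (c + d) + c) * (1 + c * 2) + p)
join-pendants c d p = block⇒inES (attach pendant p (Join.block c d))
  (vertices c d p) (cycles c p) (edges ((2 + (c + d) + c) * (1 + c * 2)) p)
  where
    vertices : ∀ c d p → suc (p * 1 + (1 + (c + d) + (1 + c * 2))) ≡ 3 + 3 * c + d + p
    vertices = solve-∀
    cycles : ∀ c p → suc (p * 0 + c) ≡ 1 + c
    cycles = solve-∀
    edges : ∀ e p → p * 1 + e ≡ e + p
    edges = solve-∀

realise : ∀ {n′ k′ m′} → n ≡ n′ → k ≡ k′ → m ≡ m′ → InES n′ k′ m′ → InES n k m
realise refl refl refl G = G

offset : m ≤ n → ∃ λ o → n ≡ m + o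
offset m≤n = map₂ ≡-sym (m≤n⇒∃[o]m+o≡n m≤n)

minimum′ : ∀ a n → 5 + 4 * a ≤ n → InES n (2 + a) (n + 6 * (2 + a) N.∸ 7)
minimum′ a n n≥ = let p , n≡ = offset n≥ in
  realise n≡ refl (trans (cong (N._∸ 7) (trans (cong (_+ 6 * (2 + a)) n≡) (total a p))) (m+n∸n≡m (10 + 10 * a + p) 7)) (K₅s a p)
  where
    total : ∀ a p → 5 + 4 * a + p + 6 * (2 + a) ≡ 10 + 10 * a + p + 7
    total = solve-∀

minimum : ∀ k n → 2 ≤ k → 4 * k N.∸ 3 ≤ n → InES n k (n + 6 * k N.∸ 7)
minimum (suc (suc a)) n _ 4k-3≤n =
  minimum′ a n (cancel-≤ 3 (total a) refl (≤-trans (m≤n+m∸n (4 * (2 + a)) 3) (+-monoʳ-≤ 3 4k-3≤n)))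
  where
    total : ∀ a → 4 * (2 + a) ≡ 3 + (5 + 4 * a)
    total = solve-∀
minimum (suc zero) _ (s≤s ())

-- Each duplicate replaces a pendant edge and adds one to the number of edges. The upper bound on
-- `m` is exactly the condition that `q` duplicates fit, and equality leaves no pendant edge.
lower-range′ : ∀ a n m q → m ≡ n + 6 * a + 5 + q → m + 6 ≤ 2 * n + 2 * (2 + a) → InES n (2 + a) m
lower-range′ a n m q m≡ high = let p , n≡ = offset n≥ in
  realise n≡ refl (trans m≡ (trans (cong (λ n → n + 6 * a + 5 + q) n≡) (edges a q p))) (twins-K₅s a q p)
  where
    lhs : ∀ n a q → n + 6 * a + 5 + q + 6 ≡ n + 2 * a + 4 + (7 + 4 * a + q)
    lhs = solve-∀
    rhs : ∀ n a → 2 * n + 2 * (2 + a) ≡ n + 2 * a + 4 + n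
    rhs = solve-∀
    edges : ∀ a q p → 7 + 4 * a + q + p + 6 * a + 5 + q ≡ 12 + 10 * a + 2 * q + p
    edges = solve-∀
    n≥ : 7 + 4 * a + q ≤ n
    n≥ = cancel-≤ (n + 2 * a + 4) (trans (cong (_+ 6) m≡) (lhs n a q)) (rhs n a) high

lower-range : ∀ k n m → 2 ≤ k → n + 6 * k ≤ m + 7 → m + 6 ≤ 2 * n + 2 * k → InES n k m
lower-range (suc (suc a)) n m _ low high =
  let q , m≡ = offset (cancel-≤ 7 (lhs n a) (+-comm m 7) low) in lower-range′ a n m q m≡ high
  where
    lhs : ∀ n a → n + 6 * (2 + a) ≡ 7 + (n + 6 * a + 5)
    lhs = solve-∀
lower-range (suc zero) _ _ (s≤s ())

halve : ∀ q j {x} → q ≤ 1 → q + j * 2 ≤ x → 2 * (q + j) ≤ 1 + x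
halve q j q≤1 ≤x = ≤-trans (≤-reflexive (regroup q j)) (+-mono-≤ q≤1 ≤x)
  where
    regroup : ∀ q j → 2 * (q + j) ≡ q + (q + j * 2)
    regroup = solve-∀

-- The join with K₃ has difference 7 + 2j, gaining two edges per replaced pendant edge, which is
-- what brings the range near 3n. At most one duplicate corrects the parity. The constant 12 is 6 +
-- 7 - 1.
middle-range′ : ∀ a n m q j → q ≤ 1 → m ≡ n + 6 * a + 12 + (q + j * 2) → m + (3 * (3 + a) + 3) ≤ 3 * n → InES n (3 + a) m
middle-range′ a n m q j q≤1 m≡ high = let p , n≡ = offset n≥ in
  realise n≡ refl (trans m≡ (trans (cong (λ n → n + 6 * a + 12 + (q + j * 2)) n≡) (edges a q j p))) (twins-join-K₅s a q j p)
  where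
    lhs : ∀ n a x → n + 6 * a + 12 + x + (3 * (3 + a) + 3) ≡ n + (24 + 9 * a + x)
    lhs = solve-∀
    rhs : ∀ n → 3 * n ≡ n + 2 * n
    rhs = solve-∀
    regroup : ∀ a q j → 2 * (12 + 4 * a + q + j) ≡ 24 + 8 * a + 2 * (q + j)
    regroup = solve-∀
    regroup′ : ∀ a x → 24 + 8 * a + (1 + x) + a ≡ suc (24 + 9 * a + x)
    regroup′ = solve-∀
    edges : ∀ a q j p → 12 + 4 * a + q + j + p + 6 * a + 12 + (q + j * 2) ≡ 24 + 10 * a + 2 * q + 3 * j + p
    edges = solve-∀
    open ≤-Reasoning
    -- Rounding costs one: the doubled vertex number is bounded by 2n + 1, which still lies below
    -- 2(n + 1).
    twice : 2 * (12 + 4 * a + q + j) < 2 * suc n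
    twice = begin-strict
      2 * (12 + 4 * a + q + j)            ≡⟨ regroup a q j ⟩
      24 + 8 * a + 2 * (q + j)            ≤⟨ +-monoʳ-≤ (24 + 8 * a) (halve q j q≤1 ≤-refl) ⟩
      24 + 8 * a + (1 + (q + j * 2))      ≤⟨ m≤m+n _ a ⟩
      24 + 8 * a + (1 + (q + j * 2)) + a  ≡⟨ regroup′ a (q + j * 2) ⟩
      suc (24 + 9 * a + (q + j * 2))      ≤⟨ s≤s (cancel-≤ n (trans (cong (_+ (3 * (3 + a) + 3)) m≡) (lhs n a (q + j * 2))) (rhs n) high) ⟩
      suc (2 * n)                         <⟨ ≤-refl ⟩
      2 + 2 * n                           ≡⟨ *-suc 2 n ⟨
      2 * suc n                           ∎
    n≥ : 12 + 4 * a + q + j ≤ n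
    n≥ = s≤s⁻¹ (*-cancelˡ-< 2 (12 + 4 * a + q + j) (suc n) twice)

middle-range : ∀ k n m → 3 ≤ k → 5 * k N.∸ 1 ≤ n → n + 6 * k ≤ m + 7 → m + (3 * k + 3) ≤ 3 * n → InES n k m
middle-range (suc (suc zero)) _ _ (s≤s (s≤s ()))
middle-range (suc zero) _ _ (s≤s ())
middle-range (suc (suc (suc a))) n m _ 5k-1≤n low high =
  by-excess (offset (cancel-≤ 7 (lhs n a) (+-comm m 7) low))
  where
    lhs : ∀ n a → n + 6 * (3 + a) ≡ 7 + (n + 6 * a + 11)
    lhs = solve-∀
    n≥ : 9 + 4 * a ≤ n
    n≥ = cancel-≤ 1 refl refl (≤-trans (≤-trans (m≤m+n (10 + 4 * a) (5 + a)) (≤-reflexive (total a)))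
                                       (≤-trans (m≤n+m∸n (5 * (3 + a)) 1) (+-monoʳ-≤ 1 5k-1≤n)))
      where
        total : ∀ a → 10 + 4 * a + (5 + a) ≡ 5 * (3 + a)
        total = solve-∀
    by-excess : (∃ λ r → m ≡ n + 6 * a + 11 + r) → InES n (3 + a) m
    -- The smallest join with K₃ has difference 7 instead of 6, so the bottom value is one too low
    -- for it; copies of K₅ supply this value.
    by-excess (zero , m≡) = realise refl refl
      (trans m≡ (≡-sym (trans (cong (N._∸ 7) (total n a)) (m+n∸n≡m (n + 6 * a + 11 + 0) 7))))
      (minimum′ (suc a) n (≤-trans (≤-reflexive (total′ a)) n≥))
      where
        total : ∀ n a → n + 6 * (3 + a) ≡ n + 6 * a + 11 + 0 + 7
        total = solve-∀
        total′ : ∀ a → 5 + 4 * (1 + a) ≡ 9 + 4 * a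
        total′ = solve-∀
    by-excess (suc r , m≡) = middle-range′ a n m (r % 2) (r / 2) (s≤s⁻¹ (m%n<n r 2))
      (trans m≡ (trans (total n a r) (cong (n + 6 * a + 12 +_) (m≡m%n+[m/n]*n r 2)))) high
      where
        total : ∀ n a r → n + 6 * a + 11 + suc r ≡ n + 6 * a + 12 + r
        total = solve-∀

-- The room left at the upper end of the range (iv) suffices for the vertices that adjust the edge number.
enough-room : ∀ b D q j → q ≤ 1 → q + j * 2 < (2 + b) * 2 → 6 + (q + j * 2) ≤ (2 + b) * 2 * (1 + D) → q + j ≤ b * 2 + D
enough-room b D q j q≤1 small room = cases b D (*-cancelˡ-≤ 2 sum≤) room
  where
    sum≤ : 2 * (q + j) ≤ 2 * (2 + b)
    sum≤ = ≤-trans (halve q j q≤1 (s≤s⁻¹ small)) (≤-reflexive (*-comm (2 + b) 2))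
    tight : ∀ z {y} → z + (q + j * 2) ≤ z + y → 2 * (q + j) ≤ 1 + y
    tight z le = halve q j q≤1 (+-cancelˡ-≤ z _ _ le)
    -- From `b = 2` on, 2 + b ≤ 2b settles it. For smaller `b` either `D` makes up the difference,
    -- or `D` is so small that `room` restricts the remainder.
    cases : ∀ b D → q + j ≤ 2 + b → 6 + (q + j * 2) ≤ (2 + b) * 2 * (1 + D) → q + j ≤ b * 2 + D
    cases 0 0 le room′ with s≤s (s≤s (s≤s (s≤s ()))) ← room′
    cases 0 1 le room′ = s≤s⁻¹ (*-cancelˡ-< 2 (q + j) 2 (s≤s (tight 6 room′)))
    cases 0 (suc (suc D)) le room′ = ≤-trans le (s≤s (s≤s z≤n))
    cases 1 0 le room′ = *-cancelˡ-≤ 2 (≤-trans (tight 6 room′) (s≤s z≤n))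
    cases 1 (suc D) le room′ = ≤-trans le (s≤s (s≤s (s≤s z≤n)))
    cases (suc (suc b)) D le room′ = ≤-trans le (≤-trans (s≤s (s≤s (s≤s (s≤s b≤)))) (m≤m+n _ D))
      where
        b≤ : b ≤ b * 2
        b≤ = ≤-trans (m≤m+n b b) (≤-reflexive (double b))
          where
            double : ∀ b → b + b ≡ b * 2
            double = solve-∀

-- A positive remainder forces `x < n`; the gap then consists of `1 + D` multiples of `w`, and the
-- remainder has to fit into them.
quotient-gap : ∀ w x n r → w * x + suc r ≤ w * n → ∃ λ D → n ≡ suc x + D × suc r ≤ w * (1 + D)
quotient-gap w x n r le = map₂ (λ {D} n≡ → n≡ , cancel-≤ (w * x) refl (trans (cong (w *_) n≡) (expand w x D)) le)
  (offset (*-cancelˡ-< w x n (≤-trans (≤-trans (≤-reflexive (+-comm 1 (w * x))) (+-monoʳ-≤ (w * x) (s≤s z≤n))) le)))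
  where
    expand : ∀ w x D → w * (suc x + D) ≡ w * x + w * (1 + D)
    expand = solve-∀

-- With c = k − 3 = 2 + b the constant 34 + 19 b + 4 b² is 12 + 3 c + 4 c².
upper-range′ : ∀ b n m d q j → q ≤ 1 → q + j * 2 < (2 + b) * 2 →
               m ≡ n + (34 + 19 * b + 4 * b * b) + (q + j * 2 + d * ((2 + b) * 2)) →
               m + (5 * n + 6 * (5 + b) * (5 + b) + 3) ≤ 2 * (5 + b) * n + 21 * (5 + b) → InES n (5 + b) m
upper-range′ b n m d q j q≤1 small m≡ high = let p , n≡ = offset n≥ in
  realise n≡ refl (trans m≡ (trans (cong (λ n → n + (34 + 19 * b + 4 * b * b) + (q + j * 2 + d * ((2 + b) * 2))) n≡) (edges b d q j p)))
    (twins-join-join (2 + b) d q j p)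
  where
    c = 2 + b
    lhs : ∀ b n d x → n + (34 + 19 * b + 4 * b * b) + (x + d * ((2 + b) * 2)) + (5 * n + 6 * (5 + b) * (5 + b) + 3) ≡
                      6 * n + (21 * (5 + b)) + ((2 + b) * 2 * (5 * (2 + b) + 9 + d) + (6 + x))
    lhs = solve-∀
    rhs : ∀ b n → 2 * (5 + b) * n + 21 * (5 + b) ≡ 6 * n + (21 * (5 + b)) + (2 + b) * 2 * n
    rhs = solve-∀
    edges : ∀ b d q j p → 14 + 3 * (2 + b) + d + q + j + p + (34 + 19 * b + 4 * b * b) + (q + j * 2 + d * ((2 + b) * 2)) ≡
                          24 + 2 * q + 3 * j + (2 + (2 + b + d) + (2 + b)) * (1 + (2 + b) * 2) + p
    edges = solve-∀

    product≤ : c * 2 * (5 * c + 9 + d) + (6 + (q + j * 2)) ≤ c * 2 * n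
    product≤ = cancel-≤ (6 * n + 21 * (5 + b)) (trans (cong (_+ (5 * n + 6 * (5 + b) * (5 + b) + 3)) m≡) (lhs b n d (q + j * 2))) (rhs b n) high

    n≥ : 14 + 3 * c + d + q + j ≤ n
    n≥ = let D , n≡ , room = quotient-gap (c * 2) (5 * c + 9 + d) n (5 + (q + j * 2)) product≤ in begin
      14 + 3 * c + d + q + j       ≡⟨ regroup b d q j ⟩
      20 + 3 * b + d + (q + j)     ≤⟨ +-monoʳ-≤ (20 + 3 * b + d) (enough-room b D q j q≤1 small room) ⟩
      20 + 3 * b + d + (b * 2 + D) ≡⟨ regroup′ b d D ⟩
      suc (5 * c + 9 + d) + D      ≡⟨ n≡ ⟨
      n                            ∎
      where
        open ≤-Reasoning
        regroup : ∀ b d q j → 14 + 3 * (2 + b) + d + q + j ≡ 20 + 3 * b + d + (q + j)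
        regroup = solve-∀
        regroup′ : ∀ b d D → 20 + 3 * b + d + (b * 2 + D) ≡ suc (5 * (2 + b) + 9 + d) + D
        regroup′ = solve-∀

upper-range : ∀ k n m → 5 ≤ k → 5 * k N.∸ 4 ≤ n → 2 * n + 4 * k * k + 34 ≤ m + 24 * k →
              m + (5 * n + 6 * k * k + 3) ≤ 2 * k * n + 21 * k → InES n k m
upper-range k n m 5≤k 5k-4≤n low high with offset 5≤k
... | b , refl = by-excess (offset (cancel-≤ (124 + 24 * b + n) (lhs n b) (rhs n m b)
    -- The lower end of the range exceeds the smallest value of this combination by n - 20 - 3b,
    -- which is nonnegative since n ≥ 5k - 4 = 21 + 5b. Both sides carry an extra 4 to undo the
    -- truncated subtraction.
    (+-mono-≤ (≤-trans (≤-trans (m≤m+n (24 + 3 * b) (1 + 2 * b)) (≤-reflexive (total b)))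
                       (≤-trans (m≤n+m∸n (5 * (5 + b)) 4) (+-monoʳ-≤ 4 5k-4≤n))) low)))
  where
    total : ∀ b → 24 + 3 * b + (1 + 2 * b) ≡ 5 * (5 + b)
    total = solve-∀
    lhs : ∀ n b → 24 + 3 * b + (2 * n + 4 * (5 + b) * (5 + b) + 34) ≡ 124 + 24 * b + n + (n + (34 + 19 * b + 4 * b * b))
    lhs = solve-∀
    rhs : ∀ n m b → 4 + n + (m + 24 * (5 + b)) ≡ 124 + 24 * b + n + m
    rhs = solve-∀
    by-excess : (∃ λ R → m ≡ n + (34 + 19 * b + 4 * b * b) + R) → InES n (5 + b) m
    -- `R` is written as q + 2j + 2c · d: `d` further vertices in the large join, `j` in the join
    -- with K₃, and at most one duplicate for the parity.
    by-excess (R , m≡) = upper-range′ b n m d (ρ % 2) (ρ / 2) (s≤s⁻¹ (m%n<n ρ 2))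
      (≤-trans (≤-reflexive (cong suc (≡-sym (m≡m%n+[m/n]*n ρ 2)))) (m%n<n R w))
      (trans m≡ (cong (n + (34 + 19 * b + 4 * b * b) +_)
        (trans (m≡m%n+[m/n]*n R w) (cong (_+ d * w) (m≡m%n+[m/n]*n ρ 2))))) high
      where
        w = (2 + b) * 2
        d = R / w
        ρ = R % w

-- A single join with c = k - 1 accounts for all k - 1 disjoint cycles. It has `t` vertices
-- including the root, 3k being the least possible number, and the other n - t vertices are pendant.
join-range : ∀ k n t → 2 ≤ k → 3 * k ≤ t → t ≤ n →
          ∃ λ m → m + (2 * k * k + 2 * t) ≡ n + k + 2 * k * t × InES n k m
join-range k n t 2≤k 3k≤t t≤n with offset 2≤k | offset 3k≤t | offset t≤n
... | a , refl | d , refl | p , refl = (2 + (1 + a + d) + (1 + a)) * (1 + (1 + a) * 2) + p , edges a d p ,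
  realise (vertices a d p) refl refl (join-pendants (1 + a) d p)
  where
    vertices : ∀ a d p → 3 * (2 + a) + d + p ≡ 3 + 3 * (1 + a) + d + p
    vertices = solve-∀
    edges : ∀ a d p → (2 + (1 + a + d) + (1 + a)) * (1 + (1 + a) * 2) + p + (2 * (2 + a) * (2 + a) + 2 * (3 * (2 + a) + d)) ≡
                      3 * (2 + a) + d + p + (2 + a) + 2 * (2 + a) * (3 * (2 + a) + d)
    edges = solve-∀

-- Passage to integer bounds

open import Data.Integer using (ℤ; +_; _-_)
import Data.Integer as Z
import Data.Integer.Properties as ℤₚ
import Data.Integer.Tactic.RingSolver as ℤ-Ring

-- The bounds are integer expressions in which subtraction is exact. Written as one difference of
-- naturals, each becomes an inequality between sums.
difference-≤ : ∀ {i a b m} → i ≡ + a - + b → i Z.≤ + m → a ≤ m + b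
difference-≤ {a = a} {b} {m} refl i≤m = ℤₚ.drop‿+≤+ (subst (Z._≤ + (m + b)) (restore (+ a) (+ b)) (ℤₚ.+-monoˡ-≤ (+ b) i≤m))
  where
    restore : ∀ x y → x - y Z.+ y ≡ x
    restore = ℤ-Ring.solve-∀

≤-difference : ∀ {i a b m} → i ≡ + a - + b → + m Z.≤ i → m + b ≤ a
≤-difference {a = a} {b} {m} refl m≤i = ℤₚ.drop‿+≤+ (subst (+ (m + b) Z.≤_) (restore (+ a) (+ b)) (ℤₚ.+-monoˡ-≤ (+ b) m≤i))
  where
    restore : ∀ x y → x - y Z.+ y ≡ x
    restore = ℤ-Ring.solve-∀

≡-difference : ∀ {i a b m} → i ≡ + a - + b → m + b ≡ a → + m ≡ i
≡-difference {b = b} {m} refl refl = restore (+ m) (+ b)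
  where
    restore : ∀ x y → x ≡ (x Z.+ y) - y
    restore = ℤ-Ring.solve-∀

middle-bound : ∀ k n → + (3 * n) - + (3 * k) - + 3 ≡ + (3 * n) - + (3 * k + 3)
middle-bound k n = regroup (+ (3 * n)) (+ (3 * k))
  where
    regroup : ∀ x y → x - y - + 3 ≡ x - (y Z.+ + 3)
    regroup = ℤ-Ring.solve-∀

upper-low : ∀ k n → + (2 * n) Z.+ + (4 * k * k) - + (24 * k) Z.+ + 34 ≡ + (2 * n + 4 * k * k + 34) - + (24 * k)
upper-low k n = regroup (+ (2 * n)) (+ (4 * k * k)) (+ (24 * k))
  where
    regroup : ∀ x y z → x Z.+ y - z Z.+ + 34 ≡ x Z.+ y Z.+ + 34 - z
    regroup = ℤ-Ring.solve-∀

upper-high : ∀ k n → (+ (2 * k) - + 5) Z.* + n - + (6 * k * k) Z.+ + (21 * k) - + 3 ≡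
                     + (2 * k * n + 21 * k) - + (5 * n + 6 * k * k + 3)
upper-high k n = trans (regroup (+ (2 * k)) (+ n) (+ (6 * k * k)) (+ (21 * k)))
  (cong₂ (λ x y → x Z.+ + (21 * k) - (y Z.+ + (6 * k * k) Z.+ + 3)) (≡-sym (ℤₚ.pos-* (2 * k) n)) (≡-sym (ℤₚ.pos-* 5 n)))
  where
    regroup : ∀ x y z w → (x - + 5) Z.* y - z Z.+ w - + 3 ≡ x Z.* y Z.+ w - (+ 5 Z.* y Z.+ z Z.+ + 3)
    regroup = ℤ-Ring.solve-∀

join-pendants-difference : ∀ k n t → + n - + (2 * k * k) Z.+ + k Z.+ (+ (2 * k) - + 2) Z.* + t ≡
                          + (n + k + 2 * k * t) - + (2 * k * k + 2 * t)
join-pendants-difference k n t = trans (regroup (+ n) (+ (2 * k * k)) (+ k) (+ (2 * k)) (+ t))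
  (cong₂ (λ x y → + n Z.+ + k Z.+ x - (+ (2 * k * k) Z.+ y)) (≡-sym (ℤₚ.pos-* (2 * k) t)) (≡-sym (ℤₚ.pos-* 2 t)))
  where
    regroup : ∀ x y z w t → x - y Z.+ z Z.+ (w - + 2) Z.* t ≡ x Z.+ z Z.+ w Z.* t - (y Z.+ + 2 Z.* t)
    regroup = ℤ-Ring.solve-∀

theorem2p3 : (∀ k n → 2 ≤ k → (3 * k) ⊔ (4 * k N.∸ 3) ≤ n → SatLe n k (n + 6 * k N.∸ 7))
    × (∀ k n → 2 ≤ k → 4 * k N.∸ 1 ≤ n → ∀ (m : ℕ) →
    (+ n Z.+ + (6 * k) - + 7) Z.≤ + m → + m Z.≤ (+ (2 * n) Z.+ + (2 * k) - + 6) → InES n k m)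
    × (∀ k n → 3 ≤ k → 5 * k N.∸ 1 ≤ n → ∀ (m : ℕ) →
    (+ n Z.+ + (6 * k) - + 7) Z.≤ + m → + m Z.≤ (+ (3 * n) - + (3 * k) - + 3) → InES n k m)
    × (∀ k n → 5 ≤ k → 5 * k N.∸ 4 ≤ n → ∀ (m : ℕ) →
    (+ (2 * n) Z.+ + (4 * k * k) - + (24 * k) Z.+ + 34) Z.≤ + m →
    + m Z.≤ ((+ (2 * k) - + 5) Z.* + n - + (6 * k * k) Z.+ + (21 * k) - + 3) → InES n k m)
    × (∀ k n → 2 ≤ k → 3 * k ≤ n → ∀ t → 3 * k ≤ t → t ≤ n →
    Σ ℕ λ m → (+ m ≡ + n - + (2 * k * k) Z.+ + k Z.+ (+ (2 * k) - + 2) Z.* + t) × InES n k m)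
theorem2p3 =
  (λ k n 2≤k ≤n → n + 6 * k N.∸ 7 , ≤-refl , minimum k n 2≤k (m⊔n≤o⇒n≤o (3 * k) _ ≤n)) ,
  (λ k n 2≤k _ m low high → lower-range k n m 2≤k (difference-≤ refl low) (≤-difference refl high)) ,
  (λ k n 3≤k ≤n m low high → middle-range k n m 3≤k ≤n (difference-≤ refl low) (≤-difference (middle-bound k n) high)) ,
  (λ k n 5≤k ≤n m low high →
    upper-range k n m 5≤k ≤n (difference-≤ (upper-low k n) low) (≤-difference (upper-high k n) high)) ,
  (λ k n 2≤k _ t 3k≤t t≤n → let m , m≡ , G = join-range k n t 2≤k 3k≤t t≤n in
    m , ≡-difference (join-pendants-difference k n t) m≡ , G)
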